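{- Let $K$ be a number field with algebraic closure $\overline{K}$, let $c\in K$, $c\neq 0$, and let $\mathcal{E}$ be the elliptic curve $y^2=x^3+c$ over $K$. Let $\zeta_3,\zeta_5\in\overline{K}$ be primitive $3$-rd and $5$-th roots of unity respectively, and put $$\delta_1:=-\frac{(-132\zeta_3+24)\zeta_5^3+(36\zeta_3+108)\zeta_5^2+(-96\zeta_3-48)\zeta_5-48\zeta_3+116}{5}.$$ Consider the five conditions: (A) $\zeta_3\notin K$; (B1) $\zeta_5+\zeta_5^{ -1}\notin K(\zeta_3)$; (B2) $\zeta_5\notin K(\zeta_3,\zeta_5+\zeta_5^{ -1})$; (C) $\sqrt[3]{\delta_1 c}\notin K(\zeta_3,\zeta_5)$; (D) $\sqrt{(\delta_1+1)c}\notin K(\zeta_3,\zeta_5)$. Then the possible degrees $d=[K_5:K]$ are the following, where in each case the listed conditions are exactly those that hold: - $d=48$ if (A), (B1), (B2), (C), (D) hold; - $d=24$ if (C) and three among (A), (B1), (B2), (D) hold; - $d=16$ if (A), (B1), (B2), (D) hold; - $d=12$ if (C) and two among (A), (B1), (B2), (D) hold; - $d=8$ if three among (A), (B1), (B2), (D) hold; - $d=6$ if (C) and one among (A), (B1), (B2), (D) hold; - $d=4$ if two among (A), (B1), (B2), (D) hold; - $d=3$ if (C) holds; - $d=2$ if one among (A), (B1), (B2), (D) holds; - $d=1$ if none of the conditions holds.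
   Context: $\mathcal{E}[5]$ denotes the $5$-torsion subgroup of $\mathcal{E}(\overline{K})$, and $K_5:=K(\mathcal{E}[5])$ is the field obtained by adjoining to $K$ the coordinates of all the points of $\mathcal{E}[5]$. The symbols $\sqrt[3]{\delta_1 c}$ and $\sqrt{(\delta_1+1)c}$ denote a fixed cube root and a fixed square root in $\overline{K}$. -}

module Defs where

open import Algebra.Apartness.Bundles using (HeytingField; HeytingCommutativeRing)
open import Algebra.Bundles using (CommutativeRing)
open import Algebra.Bundles.Raw using (RawRing)
open import Algebra.Morphism.Structures using (module RingMorphisms)
import Algebra.Definitions.RawMonoid as RawMonoidOps
import Algebra.Definitions.RawSemiring as RawSemiringOps
open import Data.Empty.Polymorphic using (⊥)
open import Data.Fin.Base using (Fin; fromℕ; toℕ)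
open import Data.List.Base using (List; []; _∷_)
import Data.List.Membership.Setoid as Membership
open import Data.Nat.Base as ℕ using (ℕ; zero; suc)
open import Data.Product.Base using (Σ; ∃; ∃₂; _×_; proj₁)
open import Data.Rational.Properties using () renaming (+-*-commutativeRing to ℚ-ring)
open import Data.Sum.Base using (_⊎_)
open import Data.Unit.Polymorphic using (⊤)
open import Function.Base using (_∘_)
open import Level using (Level; _⊔_) renaming (suc to lsuc)
open import Relation.Binary.Definitions using (Decidable)
open import Relation.Nullary.Decidable.Core using (yes; no)
open import Relation.Nullary.Negation.Core using (¬_)
open import Relation.Unary using (Pred; U)

------------------------------------------------------------------------
-- Fields

-- Classically, every field is a discrete field: take _#_ to be the negation
-- of _≈_. Taking x , y = 1# , 0# in invertible⇒# gives 1# # 0#.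
record DiscreteField c ℓ : Set (lsuc (c ⊔ ℓ)) where
  field
    heytingField : HeytingField c ℓ ℓ

  open HeytingField heytingField public

  field
    _#?_ : Decidable _#_

  commutativeRing : CommutativeRing c ℓ
  commutativeRing = HeytingCommutativeRing.commutativeRing heytingCommutativeRing

  open CommutativeRing commutativeRing public
    using (rawRing; +-rawMonoid)
  open RawRing rawRing using (rawSemiring)
  open RawMonoidOps +-rawMonoid public using (sum) renaming (_×_ to _·_)
  open RawSemiringOps rawSemiring public using (_^_)

  infix  9 _⁻¹
  infixl 7 _/_

  -- Junk value: 0# ⁻¹ = 0#.
  _⁻¹ : Carrier → Carrier
  x ⁻¹ with x #? 0#
  ... | yes x#0 = proj₁ (#⇒invertible x#0)
  ... | no  _   = 0#

  _/_ : Carrier → Carrier → Carrier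
  x / y = x * y ⁻¹

  -- The polynomial a₀ + a₁ X + … + aₙ₋₁ Xⁿ⁻¹ evaluated at z.
  evaluate : ∀ {n} → (Fin n → Carrier) → Carrier → Carrier
  evaluate a z = sum (λ i → a i * z ^ toℕ i)

  PrimitiveRoot : ℕ → Carrier → Set ℓ
  PrimitiveRoot n z =
    z ^ n ≈ 1# × (∀ m → 0 ℕ.< m → m ℕ.< n → ¬ (z ^ m ≈ 1#))

------------------------------------------------------------------------
-- Extensions and degrees

record Extension {a ℓ b m} (R : CommutativeRing a ℓ) (S : CommutativeRing b m)
       : Set (a ⊔ ℓ ⊔ b ⊔ m) where
  private
    module R = CommutativeRing R
    module S = CommutativeRing S
  open RingMorphisms R.rawRing S.rawRing
  open RawMonoidOps S.+-rawMonoid using (sum)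

  field
    embed              : R.Carrier → S.Carrier
    isRingHomomorphism : IsRingHomomorphism embed

  combination : ∀ {d} → (Fin d → R.Carrier) → (Fin d → S.Carrier) → S.Carrier
  combination a e = sum (λ i → embed (a i) S.* e i)

  -- HasDegree P d: the R-submodule P of S has a basis of d elements.
  HasDegree : ∀ {p} → Pred S.Carrier p → ℕ → Set (a ⊔ ℓ ⊔ b ⊔ m ⊔ p)
  HasDegree P d = Σ (Fin d → S.Carrier) λ e →
    (∀ i → P (e i)) ×
    (∀ x → P x → ∃ λ a → x S.≈ combination a e) ×
    (∀ a → combination a e S.≈ S.0# → ∀ i → a i R.≈ R.0#)

record NumberField c ℓ : Set (lsuc (c ⊔ ℓ)) where
  field
    discreteField : DiscreteField c ℓ

  open DiscreteField discreteField public

  field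
    rationals : Extension ℚ-ring commutativeRing
    finite    : ∃ λ d → Extension.HasDegree rationals U d

record AlgebraicClosure {c ℓ} (K : DiscreteField c ℓ) c′ ℓ′
       : Set (c ⊔ ℓ ⊔ lsuc (c′ ⊔ ℓ′)) where
  private module K = DiscreteField K
  field
    discreteField : DiscreteField c′ ℓ′

  open DiscreteField discreteField public

  field
    extension : Extension K.commutativeRing commutativeRing

  open Extension extension public

  field
    algebraic : ∀ z → ∃ λ n → Σ (Fin n → K.Carrier) λ a →
      (∃ λ i → ¬ (a i K.≈ K.0#)) × evaluate (embed ∘ a) z ≈ 0#
    algebraicallyClosed : ∀ n (a : Fin (suc (suc n)) → Carrier) →
      ¬ (a (fromℕ (suc n)) ≈ 0#) → ∃ λ z → evaluate a z ≈ 0#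

------------------------------------------------------------------------
-- Intermediate fields, the curve y² = x³ + c and its 5-torsion

module Setting {c ℓ c′ ℓ′} (K : NumberField c ℓ)
       (K̄ : AlgebraicClosure (NumberField.discreteField K) c′ ℓ′) where

  private module K = NumberField K
  open AlgebraicClosure K̄
  open Membership setoid using (_∈_)

  data InK (x : Carrier) : Set (c ⊔ c′ ⊔ ℓ′) where
    image : ∀ a → x ≈ embed a → InK x

  -- K⟮ S ⟯ is the subfield of K̄ generated by K and S.
  data K⟮_⟯ (S : Pred Carrier (c′ ⊔ ℓ′)) : Pred Carrier (c ⊔ c′ ⊔ ℓ′) where
    base : ∀ a → K⟮ S ⟯ (embed a)
    gen  : ∀ {x} → S x → K⟮ S ⟯ x
    add  : ∀ {x y} → K⟮ S ⟯ x → K⟮ S ⟯ y → K⟮ S ⟯ (x + y)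
    neg  : ∀ {x} → K⟮ S ⟯ x → K⟮ S ⟯ (- x)
    mul  : ∀ {x y} → K⟮ S ⟯ x → K⟮ S ⟯ y → K⟮ S ⟯ (x * y)
    inv  : ∀ {x} → ¬ (x ≈ 0#) → K⟮ S ⟯ x → K⟮ S ⟯ (x ⁻¹)
    resp : ∀ {x y} → x ≈ y → K⟮ S ⟯ x → K⟮ S ⟯ y

  K⟨_⟩ : List Carrier → Pred Carrier (c ⊔ c′ ⊔ ℓ′)
  K⟨ xs ⟩ = K⟮ _∈ xs ⟯

  data Point : Set c′ where
    𝒪   : Point
    aff : (x y : Carrier) → Point

  OnCurve : K.Carrier → Pred Point ℓ′
  OnCurve c 𝒪         = ⊤
  OnCurve c (aff x y) = y ^ 2 ≈ x ^ 3 + embed c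

  private
    -- Third intersection with the line of slope m through (x₁ , y₁) and
    -- (x₂ , y₂), reflected in the x-axis.
    chord : (m x₁ y₁ x₂ : Carrier) → Point
    chord m x₁ y₁ x₂ = aff x₃ (m * (x₁ - x₃) - y₁)
      where x₃ = m ^ 2 - x₁ - x₂

  infixl 6 _⊕_

  -- The group law of y² = x³ + c. The formulas do not involve c; they are
  -- meaningful for two points satisfying OnCurve c for the same c. For such
  -- points with equal x-coordinate, either y₁ + y₂ ≈ 0# or the points coincide.
  _⊕_ : Point → Point → Point
  𝒪 ⊕ Q = Q
  P@(aff _ _) ⊕ 𝒪 = P
  aff x₁ y₁ ⊕ aff x₂ y₂ with x₁ #? x₂ | (y₁ + y₂) #? 0#
  ... | yes _ | _     = chord ((y₂ - y₁) / (x₂ - x₁)) x₁ y₁ x₂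
  ... | no  _ | yes _ = chord ((3 · x₁ ^ 2) / (2 · y₁)) x₁ y₁ x₂
  ... | no  _ | no  _ = 𝒪

  infixr 8 _⊛_

  _⊛_ : ℕ → Point → Point
  zero  ⊛ P = 𝒪
  suc n ⊛ P = P ⊕ n ⊛ P

  Is𝒪 : Pred Point ℓ′
  Is𝒪 𝒪         = ⊤
  Is𝒪 (aff _ _) = ⊥

  Torsion : ℕ → K.Carrier → Pred Point ℓ′
  Torsion n c P = OnCurve c P × Is𝒪 (n ⊛ P)

  TorsionCoordinate : ℕ → K.Carrier → Pred Carrier (c′ ⊔ ℓ′)
  TorsionCoordinate n c z =
    ∃₂ λ x y → Torsion n c (aff x y) × (z ≈ x ⊎ z ≈ y)

  -- The n-division field K(ℰ[n]) of ℰ : y² = x³ + c.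
  DivisionField : ℕ → K.Carrier → Pred Carrier (c ⊔ c′ ⊔ ℓ′)
  DivisionField n c = K⟮ TorsionCoordinate n c ⟯

  δ₁ : (ζ₃ ζ₅ : Carrier) → Carrier
  δ₁ ζ₃ ζ₅ = -
    ( ( (- (132 · ζ₃) + 24 · 1#) * ζ₅ ^ 3
      + (36 · ζ₃ + 108 · 1#) * ζ₅ ^ 2
      + (- (96 · ζ₃) - 48 · 1#) * ζ₅
      - 48 · ζ₃ + 116 · 1# )
    / (5 · 1#) )

------------------------------------------------------------------------
-- Counting

-- Exactly n of the propositions Ps are false; evidence also says which ones.
data ExactlyFalse {a : Level} : ℕ → List (Set a) → Set (lsuc a) where
  []     : ExactlyFalse 0 []
  false∷ : ∀ {n P Ps} → ¬ P → ExactlyFalse n Ps → ExactlyFalse (suc n) (P ∷ Ps)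
  true∷  : ∀ {n P Ps} → P → ExactlyFalse n Ps → ExactlyFalse n (P ∷ Ps)

{-# OPTIONS --safe #-}
module Submission where

-- Put t = x³/c for a 5-torsion point P = (x , y). The condition 5P = 𝒪 says that the tangents at P
-- and at 2P fit together, which is a quartic equation in t; it splits over ℚ(ζ₃ , ζ₅), with root δ₁.
-- Hence P₀ = (∛(δ₁c) , √((δ₁+1)c)) is a 5-torsion point. The endomorphisms 2 and √-3 move P₀ to points
-- (r x₀ , s y₀) with r , s in ℚ(ζ₃ , ζ₅) realising the other three roots, so up to the automorphisms
-- (x , y) ↦ (ζ₃ⁱ x , ± y) these are all 5-torsion points, and K₅ = K(ζ₃ , ζ₅ , x₀ , y₀). Conversely ζ₅ is
-- recovered from the ratios r , s. The degree is then computed along the tower adjoining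
-- ζ₃ , ζ₅ + ζ₅⁻¹ , ζ₅ , x₀ , y₀, where a square root in a pure cubic extension already lies in the base.

-- With t = x³/c, the point 2P is ((t - 8)/(4(t + 1)) x , (t² + 20t - 8)/(8(t + 1)²) y) and √-3 P is
-- (-(t + 4)/(3t) x , (t - 8)/(3√-3 t) y). At t = δ₁ these ratios are integral combinations of
-- products of ζ₃, η = ζ₅ + ζ₅⁻¹ and ζ₅; they are the tables `r` and `s`. With the denominator 5 of
-- δ₁ cleared, every cyclotomic identity becomes an equation between octuples of integers, checked
-- by evaluation and carried to the closure by a ring homomorphism. That homomorphism exists whether
-- or not ζ₃ and ζ₅ lie in K, so the same identities serve all cases. The group law is a case
-- distinction and its associativity is never invoked: P, 2P, 3P, 4P are followed explicitly, and 5P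
-- = 𝒪 is read as 3P = - 2P. Membership in a subfield is not decidable. The degree formula therefore
-- takes five decisions as arguments; the counting hypotheses contain them, and the final clause
-- obtains them under a double negation. ζ₃ and ζ₅ stand at the bottom of the tower so that the
-- cubic step has cube roots of unity available, which leaves it only the degrees 1 and 3.

open import Defs
open import Algebra.Bundles using (CommutativeRing)
open import Algebra.Bundles.Raw using (RawRing)
open import Algebra.Morphism.Structures using (module RingMorphisms)
open import Algebra.Solver.Ring.AlmostCommutativeRing
  using (AlmostCommutativeRing; fromCommutativeRing; _-Raw-AlmostCommutative⟶_; Induced-equivalence)
import Algebra.Apartness.Properties.HeytingCommutativeRing as HeytingProperties
import Algebra.Properties.Ring as RingProperties
import Algebra.Properties.Semiring.Exp as SemiringExp
import Algebra.Properties.Semiring.Mult as Mult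
import Algebra.Properties.Semiring.Sum as SemiringSum
import Algebra.Solver.Ring as RingSolver
open import Data.Bool.Base using (T; if_then_else_)
open import Data.Empty using (⊥; ⊥-elim)
open import Data.Fin.Base using (Fin; zero; suc; combine; remQuot; _↑ˡ_; _↑ʳ_)
import Data.Fin.Properties as Fin
open import Data.Integer.Base as ℤ using (ℤ; +_; -[1+_]; _⊖_)
import Data.Integer.Properties as ℤ
open import Data.List.Base using (List; []; _∷_; length)
import Data.List.Membership.Setoid as Membership
open import Data.List.Relation.Unary.Any using (Any; here; there)
open import Data.Maybe.Base as Maybe using (Maybe; just; is-just)
open import Data.Nat.Base as ℕ using (ℕ; zero; suc; _≤_; z≤n; s≤s)
import Data.Nat.Properties as ℕ
open import Data.Nat.Solver using (module +-*-Solver)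
open import Data.Product.Base using (_×_; _,_; proj₁; proj₂; ∃; ∃₂; Σ; map₂)
import Data.Rational.Base as ℚ
import Data.Rational.Properties as ℚ
open import Data.Sum.Base using (_⊎_; inj₁; inj₂; [_,_]′)
open import Data.Unit.Polymorphic using (tt)
open import Data.Vec.Base using (Vec; []; _∷_; lookup)
open import Function.Base using (_∘_; id; case_of_)
open import Level using (0ℓ; _⊔_)
open import Relation.Binary.Definitions using (DecidableEquality; WeaklyDecidable)
open import Relation.Binary.PropositionalEquality.Core as ≡ using (_≡_)
open import Relation.Nullary.Decidable.Core
  using (yes; no; Dec; does; map′; dec⇒maybe; toWitness; ¬¬-excluded-middle)
open import Relation.Nullary.Negation.Core using (¬_; contradiction)
open import Relation.Unary using (Pred; _⊆_)

-- Ring solvers with coefficients in ℤ and in ℤ[ζ₃ , ζ₅]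

module IntegerCoefficients {a ℓ} (R : CommutativeRing a ℓ) where
  open CommutativeRing R
  open RingProperties ring
  open Mult semiring using (×-homo-+; ×-assoc-*; ×1-homo-*; ×-congʳ) renaming (_×_ to _·_)
  open import Relation.Binary.Reasoning.Setoid setoid

  -- Opaque, so that type checking never unfolds a numeral into a sum of ones.
  opaque
    fromℤ : ℤ → Carrier
    fromℤ (+ n)    = n · 1#
    fromℤ -[1+ n ] = - (suc n · 1#)

    fromℤ-0 : fromℤ (+ 0) ≈ 0#
    fromℤ-0 = refl

    fromℤ-1 : fromℤ (+ 1) ≈ 1#
    fromℤ-1 = +-identityʳ 1#

    fromℤ-· : ∀ n x → n · x ≈ fromℤ (+ n) * x
    fromℤ-· n x = sym (trans (×-assoc-* n 1# x) (×-congʳ n (*-identityˡ x)))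

    fromℤ-neg : ∀ i → fromℤ (ℤ.- i) ≈ - fromℤ i
    fromℤ-neg (+ zero)  = sym -0#≈0#
    fromℤ-neg (+ suc n) = refl
    fromℤ-neg -[1+ n ]  = sym (-‿involutive _)

    fromℤ-⊖ : ∀ m n → fromℤ (m ⊖ n) ≈ m · 1# - n · 1#
    fromℤ-⊖ m zero = sym (trans (+-congˡ -0#≈0#) (+-identityʳ _))
    fromℤ-⊖ zero (suc n) = sym (+-identityˡ _)
    fromℤ-⊖ (suc m) (suc n) = begin
      fromℤ (suc m ⊖ suc n)             ≡⟨ ≡.cong fromℤ (ℤ.[1+m]⊖[1+n]≡m⊖n m n) ⟩
      fromℤ (m ⊖ n)                     ≈⟨ fromℤ-⊖ m n ⟩
      m · 1# - n · 1#                   ≈⟨ +-congʳ (+-identityʳ _) ⟨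
      m · 1# + 0# - n · 1#              ≈⟨ +-congʳ (+-congˡ (-‿inverseʳ 1#)) ⟨
      m · 1# + (1# - 1#) - n · 1#       ≈⟨ +-congʳ (+-assoc _ _ _) ⟨
      (m · 1# + 1#) - 1# - n · 1#       ≈⟨ +-assoc _ _ _ ⟩
      (m · 1# + 1#) + (- 1# - n · 1#)   ≈⟨ +-cong (+-comm _ _) (-‿+-comm 1# (n · 1#)) ⟩
      suc m · 1# - suc n · 1#           ∎

    fromℤ-+ : ∀ i j → fromℤ (i ℤ.+ j) ≈ fromℤ i + fromℤ j
    fromℤ-+ (+ m)    (+ n)    = ×-homo-+ 1# m n
    fromℤ-+ (+ m)    -[1+ n ] = fromℤ-⊖ m (suc n)
    fromℤ-+ -[1+ m ] (+ n)    = trans (fromℤ-⊖ n (suc m)) (+-comm _ _)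
    fromℤ-+ -[1+ m ] -[1+ n ] = begin
      - (suc (suc (m ℕ.+ n)) · 1#)     ≈⟨ -‿cong (+-assoc 1# 1# _) ⟨
      - ((1# + 1#) + (m ℕ.+ n) · 1#)   ≈⟨ -‿cong (+-congˡ (×-homo-+ 1# m n)) ⟩
      - ((1# + 1#) + (m · 1# + n · 1#)) ≈⟨ -‿cong (+-assoc 1# 1# _) ⟩
      - (1# + (1# + (m · 1# + n · 1#))) ≈⟨ -‿cong (+-congˡ (+-assoc 1# _ _)) ⟨
      - (1# + ((1# + m · 1#) + n · 1#)) ≈⟨ -‿cong (+-congˡ (+-congʳ (+-comm 1# _))) ⟩
      - (1# + ((m · 1# + 1#) + n · 1#)) ≈⟨ -‿cong (+-congˡ (+-assoc _ 1# _)) ⟩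
      - (1# + (m · 1# + (1# + n · 1#))) ≈⟨ -‿cong (+-assoc 1# _ _) ⟨
      - (suc m · 1# + suc n · 1#)      ≈⟨ -‿+-comm _ _ ⟨
      - (suc m · 1#) - suc n · 1#      ∎

    fromℤ-*+ : ∀ i n → fromℤ (i ℤ.* + n) ≈ fromℤ i * fromℤ (+ n)
    fromℤ-*+ (+ m) n = trans (reflexive (≡.cong fromℤ (≡.sym (ℤ.pos-* m n)))) (×1-homo-* m n)
    fromℤ-*+ -[1+ m ] n = begin
      fromℤ (ℤ.- (+ suc m) ℤ.* + n)   ≡⟨ ≡.cong fromℤ (ℤ.neg-distribˡ-* (+ suc m) (+ n)) ⟨
      fromℤ (ℤ.- (+ suc m ℤ.* + n))   ≈⟨ fromℤ-neg (+ suc m ℤ.* + n) ⟩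
      - fromℤ (+ suc m ℤ.* + n)       ≈⟨ -‿cong (fromℤ-*+ (+ suc m) n) ⟩
      - (fromℤ (+ suc m) * fromℤ (+ n)) ≈⟨ -‿distribˡ-* _ _ ⟩
      fromℤ -[1+ m ] * fromℤ (+ n)    ∎

    fromℤ-* : ∀ i j → fromℤ (i ℤ.* j) ≈ fromℤ i * fromℤ j
    fromℤ-* i (+ n) = fromℤ-*+ i n
    fromℤ-* i -[1+ n ] = begin
      fromℤ (i ℤ.* ℤ.- (+ suc n))     ≡⟨ ≡.cong fromℤ (ℤ.neg-distribʳ-* i (+ suc n)) ⟨
      fromℤ (ℤ.- (i ℤ.* + suc n))     ≈⟨ fromℤ-neg (i ℤ.* + suc n) ⟩
      - fromℤ (i ℤ.* + suc n)         ≈⟨ -‿cong (fromℤ-*+ i (suc n)) ⟩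
      - (fromℤ i * fromℤ (+ suc n))   ≈⟨ -‿distribʳ-* _ _ ⟩
      fromℤ i * fromℤ -[1+ n ]        ∎

  almostCommutativeRing : AlmostCommutativeRing a ℓ
  almostCommutativeRing = fromCommutativeRing R

  ℤ-morphism : ℤ.+-*-rawRing -Raw-AlmostCommutative⟶ almostCommutativeRing
  ℤ-morphism = record
    { ⟦_⟧    = fromℤ
    ; +-homo = fromℤ-+
    ; *-homo = fromℤ-*
    ; -‿homo = fromℤ-neg
    ; 0-homo = fromℤ-0
    ; 1-homo = fromℤ-1
    }

  _ℤ≟_ : WeaklyDecidable (Induced-equivalence ℤ-morphism)
  i ℤ≟ j = Maybe.map (λ { ≡.refl → refl }) (dec⇒maybe (i ℤ.≟ j))

  module ℤ-Solver = RingSolver ℤ.+-*-rawRing almostCommutativeRing ℤ-morphism _ℤ≟_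

-- A data type rather than a product: without η, products of symbolic elements do not
-- unfold into coordinates during type checking.
infix 5 _+θ_
data Adjoin {c} (C : Set c) : Set c where
  _+θ_ : C → C → Adjoin C

≡-dec : ∀ {c} {C : Set c} → DecidableEquality C → DecidableEquality (Adjoin C)
≡-dec _≟_ (u +θ v) (u′ +θ v′) with u ≟ u′ | v ≟ v′
... | yes ≡.refl | yes ≡.refl = yes ≡.refl
... | no  u≢u′   | _          = no λ { ≡.refl → u≢u′ ≡.refl }
... | _          | no  v≢v′   = no λ { ≡.refl → v≢v′ ≡.refl }

-- C[θ] with θ² = p θ + q.
module _ {c ℓ} (C : RawRing c ℓ) (p q : RawRing.Carrier C) where
  private module C = RawRing C

  adjoinRoot : RawRing c c
  adjoinRoot = record
    { Carrier = Adjoin C.Carrier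
    ; _≈_     = _≡_
    ; _+_     = λ { (u +θ v) (u′ +θ v′) → u C.+ u′ +θ v C.+ v′ }
    ; _*_     = λ { (u +θ v) (u′ +θ v′) → let w = v C.* v′ in
                    u C.* u′ C.+ w C.* q +θ (u C.* v′ C.+ v C.* u′) C.+ w C.* p }
    ; -_      = λ { (u +θ v) → C.- u +θ C.- v }
    ; 0#      = C.0# +θ C.0#
    ; 1#      = C.1# +θ C.0#
    }

module AdjoinRoot {c ℓ₀ a ℓ} (C : RawRing c ℓ₀) (p q : RawRing.Carrier C) (R : CommutativeRing a ℓ)
  (morphism : C -Raw-AlmostCommutative⟶ fromCommutativeRing R) where

  open CommutativeRing R
  open IntegerCoefficients R using (module ℤ-Solver)
  open ℤ-Solver
  open _-Raw-AlmostCommutative⟶_ morphism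
    renaming (⟦_⟧ to ⟦_⟧ᶜ)
  private module C = RawRing C
  open import Relation.Binary.Reasoning.Setoid setoid

  adjoinRoot-morphism : ∀ {θ} → θ * θ ≈ ⟦ p ⟧ᶜ * θ + ⟦ q ⟧ᶜ →
    adjoinRoot C p q -Raw-AlmostCommutative⟶ fromCommutativeRing R
  adjoinRoot-morphism {θ} θ²≈pθ+q = record
    { ⟦_⟧    = λ { (u +θ v) → ⟦ u ⟧ᶜ + ⟦ v ⟧ᶜ * θ }
    ; +-homo = λ { (u +θ v) (u′ +θ v′) → trans (+-cong (+-homo u u′) (*-congʳ (+-homo v v′)))
        (solve 5 (λ u v u′ v′ θ → (u :+ u′) :+ (v :+ v′) :* θ := (u :+ v :* θ) :+ (u′ :+ v′ :* θ))
          refl ⟦ u ⟧ᶜ ⟦ v ⟧ᶜ ⟦ u′ ⟧ᶜ ⟦ v′ ⟧ᶜ θ) }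
    ; *-homo = λ { (u +θ v) (u′ +θ v′) → begin
        ⟦ u C.* u′ C.+ (v C.* v′) C.* q ⟧ᶜ + ⟦ (u C.* v′ C.+ v C.* u′) C.+ (v C.* v′) C.* p ⟧ᶜ * θ
          ≈⟨ +-cong
               (trans (+-homo _ _) (+-cong (*-homo u u′) (trans (*-homo _ q) (*-congʳ (*-homo v v′)))))
               (*-congʳ (trans (+-homo _ _) (+-cong
                 (trans (+-homo _ _) (+-cong (*-homo u v′) (*-homo v u′)))
                 (trans (*-homo _ p) (*-congʳ (*-homo v v′)))))) ⟩
        (⟦ u ⟧ᶜ * ⟦ u′ ⟧ᶜ + (⟦ v ⟧ᶜ * ⟦ v′ ⟧ᶜ) * ⟦ q ⟧ᶜ)
          + ((⟦ u ⟧ᶜ * ⟦ v′ ⟧ᶜ + ⟦ v ⟧ᶜ * ⟦ u′ ⟧ᶜ) + (⟦ v ⟧ᶜ * ⟦ v′ ⟧ᶜ) * ⟦ p ⟧ᶜ) * θ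
          ≈⟨ solve 7 (λ u v u′ v′ θ p q →
               (u :* u′ :+ (v :* v′) :* q) :+ ((u :* v′ :+ v :* u′) :+ (v :* v′) :* p) :* θ
               := u :* u′ :+ (u :* v′ :+ v :* u′) :* θ :+ v :* v′ :* (p :* θ :+ q))
               refl ⟦ u ⟧ᶜ ⟦ v ⟧ᶜ ⟦ u′ ⟧ᶜ ⟦ v′ ⟧ᶜ θ ⟦ p ⟧ᶜ ⟦ q ⟧ᶜ ⟩
        ⟦ u ⟧ᶜ * ⟦ u′ ⟧ᶜ + (⟦ u ⟧ᶜ * ⟦ v′ ⟧ᶜ + ⟦ v ⟧ᶜ * ⟦ u′ ⟧ᶜ) * θ
          + ⟦ v ⟧ᶜ * ⟦ v′ ⟧ᶜ * (⟦ p ⟧ᶜ * θ + ⟦ q ⟧ᶜ)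
          ≈⟨ +-congˡ (*-congˡ θ²≈pθ+q) ⟨
        ⟦ u ⟧ᶜ * ⟦ u′ ⟧ᶜ + (⟦ u ⟧ᶜ * ⟦ v′ ⟧ᶜ + ⟦ v ⟧ᶜ * ⟦ u′ ⟧ᶜ) * θ
          + ⟦ v ⟧ᶜ * ⟦ v′ ⟧ᶜ * (θ * θ)
          ≈⟨ solve 5 (λ u v u′ v′ θ →
               u :* u′ :+ (u :* v′ :+ v :* u′) :* θ :+ v :* v′ :* (θ :* θ)
               := (u :+ v :* θ) :* (u′ :+ v′ :* θ))
               refl ⟦ u ⟧ᶜ ⟦ v ⟧ᶜ ⟦ u′ ⟧ᶜ ⟦ v′ ⟧ᶜ θ ⟩
        (⟦ u ⟧ᶜ + ⟦ v ⟧ᶜ * θ) * (⟦ u′ ⟧ᶜ + ⟦ v′ ⟧ᶜ * θ) ∎ }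
    ; -‿homo = λ { (u +θ v) → trans (+-cong (-‿homo u) (*-congʳ (-‿homo v)))
        (solve 3 (λ u v θ → (:- u) :+ (:- v) :* θ := :- (u :+ v :* θ)) refl ⟦ u ⟧ᶜ ⟦ v ⟧ᶜ θ) }
    ; 0-homo = trans (+-cong 0-homo (trans (*-congʳ 0-homo) (zeroˡ θ))) (+-identityˡ 0#)
    ; 1-homo = trans (+-cong 1-homo (trans (*-congʳ 0-homo) (zeroˡ θ))) (+-identityʳ 1#)
    }

-- Unlike the reflexivity proofs of `solve`, this compares the coefficients by evaluation.
module SolverByEvaluation {c ℓ₀ a ℓ} (C : RawRing c ℓ₀) (R : AlmostCommutativeRing a ℓ)
  (morphism : C -Raw-AlmostCommutative⟶ R)
  (_≟_ : WeaklyDecidable (Induced-equivalence morphism)) where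

  open AlmostCommutativeRing R using (_≈_; sym; trans)
  open RingSolver C R morphism _≟_

  identity : ∀ {n} (p q : Polynomial n) → T (is-just (normalise p ≟N normalise q)) →
    ∀ ρ → ⟦ p ⟧ ρ ≈ ⟦ q ⟧ ρ
  identity p q holds ρ = extract (normalise p ≟N normalise q) holds
    where
    extract : (p≟q : Maybe (normalise p ≈N normalise q)) → T (is-just p≟q) → ⟦ p ⟧ ρ ≈ ⟦ q ⟧ ρ
    extract (just p≈q) _ = trans (sym (correct p ρ)) (trans (⟦ p≈q ⟧N-cong ρ) (correct q ρ))

module MorphismProperties {c ℓ₀ a ℓ} (C : RawRing c ℓ₀) (R : CommutativeRing a ℓ)
  (morphism : C -Raw-AlmostCommutative⟶ fromCommutativeRing R) where

  open CommutativeRing R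
  open SemiringExp semiring using (_^_)
  open _-Raw-AlmostCommutative⟶_ morphism
  private module C = RawRing C

  *-square : ∀ {u v w} → u C.* (v C.* v) ≡ w → ⟦ u ⟧ * ⟦ v ⟧ ^ 2 ≈ ⟦ w ⟧
  *-square {u} {v} ≡.refl = trans (*-congˡ (trans (*-congˡ (*-identityʳ _)) (sym (*-homo v v))))
    (sym (*-homo u (v C.* v)))

  *-cube : ∀ {u v w} → u C.* (v C.* (v C.* v)) ≡ w → ⟦ u ⟧ * ⟦ v ⟧ ^ 3 ≈ ⟦ w ⟧
  *-cube {u} {v} ≡.refl = trans (*-congˡ (*-square {v} {v} ≡.refl)) (sym (*-homo u (v C.* (v C.* v))))

-- The relations are ω² = -ω - 1, η² = -η + 1 and ζ² = ηζ - 1, with η in the role of ζ₅ + ζ₅⁻¹. Two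
-- quadratic steps in place of the quartic Φ₅ mirror the tower used for the degree.
ℤ[ω] ℤ[ω,η] ℤ[ω,η,ζ] : RawRing 0ℓ 0ℓ
ℤ[ω]     = adjoinRoot ℤ.+-*-rawRing -[1+ 0 ] -[1+ 0 ]
ℤ[ω,η]   = adjoinRoot ℤ[ω] (RawRing.-_ ℤ[ω] (RawRing.1# ℤ[ω])) (RawRing.1# ℤ[ω])
ℤ[ω,η,ζ] = adjoinRoot ℤ[ω,η] (RawRing.0# ℤ[ω] +θ RawRing.1# ℤ[ω]) (RawRing.-_ ℤ[ω,η] (RawRing.1# ℤ[ω,η]))

module A = RawRing ℤ[ω,η,ζ]

infix 4 _≟ζ_
_≟ζ_ : DecidableEquality A.Carrier
_≟ζ_ = ≡-dec _≟η_
  where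
  _≟ω_ : DecidableEquality (RawRing.Carrier ℤ[ω])
  _≟ω_ = ≡-dec ℤ._≟_
  _≟η_ : DecidableEquality (RawRing.Carrier ℤ[ω,η])
  _≟η_ = ≡-dec _≟ω_

module CyclotomicCoefficients {a ℓ} (R : CommutativeRing a ℓ) where

  open CommutativeRing R
  open IntegerCoefficients R
  open AdjoinRoot
  open _-Raw-AlmostCommutative⟶_

  private
    ⟦-1⟧ : ∀ {c ℓ₀} {C : RawRing c ℓ₀} (m : C -Raw-AlmostCommutative⟶ almostCommutativeRing) →
           - 1# ≈ ⟦ m ⟧ (RawRing.-_ C (RawRing.1# C))
    ⟦-1⟧ m = sym (trans (-‿homo m _) (-‿cong (1-homo m)))

  module Cyclotomic (ω η ζ : Carrier) (ω²≈-ω-1 : ω * ω ≈ - 1# * ω + - 1#)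
    (η²≈1-η : η * η ≈ - 1# * η + 1#) (ζ²≈ηζ-1 : ζ * ζ ≈ η * ζ + - 1#) where

    ω-morphism : ℤ[ω] -Raw-AlmostCommutative⟶ almostCommutativeRing
    ω-morphism = adjoinRoot-morphism _ _ _ R ℤ-morphism
      (trans ω²≈-ω-1 (+-cong (*-congʳ (⟦-1⟧ ℤ-morphism)) (⟦-1⟧ ℤ-morphism)))

    η-morphism : ℤ[ω,η] -Raw-AlmostCommutative⟶ almostCommutativeRing
    η-morphism = adjoinRoot-morphism _ _ _ R ω-morphism
      (trans η²≈1-η (+-cong (*-congʳ (⟦-1⟧ ω-morphism)) (sym (1-homo ω-morphism))))

    ζ-morphism : ℤ[ω,η,ζ] -Raw-AlmostCommutative⟶ almostCommutativeRing
    ζ-morphism = adjoinRoot-morphism _ _ _ R η-morphism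
      (trans ζ²≈ηζ-1 (+-cong (*-congʳ ⟦η⟧) (⟦-1⟧ η-morphism)))
      where
      ⟦η⟧ : η ≈ ⟦ η-morphism ⟧ (RawRing.0# ℤ[ω] +θ RawRing.1# ℤ[ω])
      ⟦η⟧ = sym (trans (+-cong (0-homo ω-morphism) (trans (*-congʳ (1-homo ω-morphism)) (*-identityˡ η)))
                       (+-identityˡ η))

    open MorphismProperties ℤ[ω,η,ζ] R ζ-morphism public

    _ζ≟_ : WeaklyDecidable (Induced-equivalence ζ-morphism)
    a ζ≟ b = Maybe.map (λ { ≡.refl → refl }) (dec⇒maybe (a ≟ζ b))

    module ζ-Solver = RingSolver ℤ[ω,η,ζ] almostCommutativeRing ζ-morphism _ζ≟_

    open SolverByEvaluation ℤ[ω,η,ζ] almostCommutativeRing ζ-morphism _ζ≟_ public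
      renaming (identity to ζ-identity)

-- Fields of characteristic zero

module FieldProperties {c ℓ} (F : DiscreteField c ℓ) where
  open DiscreteField F
  open CommutativeRing commutativeRing public
    using (ring; semiring)
  open IntegerCoefficients commutativeRing public
  open ℤ-Solver
  open RingProperties ring public using (-0#≈0#; x∙y⁻¹≈ε⇒x≈y; x≈y⇒x∙y⁻¹≈ε)
  open import Relation.Binary.Reasoning.Setoid setoid

  #⇒≉ : ∀ {x y} → x # y → ¬ (x ≈ y)
  #⇒≉ {x} {y} x#y x≈y = proj₂ (tight x y) x≈y x#y

  infix 4 _≈?_
  _≈?_ : ∀ x y → Dec (x ≈ y)
  x ≈? y with x #? y
  ... | yes x#y = no (#⇒≉ x#y)
  ... | no ¬x#y = yes (proj₁ (tight x y) ¬x#y)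

  1≉0 : ¬ (1# ≈ 0#)
  1≉0 = #⇒≉ (HeytingProperties.1#0 heytingCommutativeRing)

  *-inverseʳ : ∀ {x} → ¬ (x ≈ 0#) → x * x ⁻¹ ≈ 1#
  *-inverseʳ {x} x≉0 with x #? 0#
  -- The inverse supplied by `#⇒invertible` is that of `x - 0#`.
  ... | yes x#0 = trans (*-congʳ (sym (trans (+-congˡ -0#≈0#) (+-identityʳ x))))
                        (proj₂ (proj₂ (#⇒invertible x#0)))
  ... | no ¬x#0 = ⊥-elim (x≉0 (proj₁ (tight x 0#) ¬x#0))

  *-cancel-0 : ∀ {x y} → ¬ (x ≈ 0#) → x * y ≈ 0# → y ≈ 0#
  *-cancel-0 {x} {y} x≉0 xy≈0 = begin
    y                ≈⟨ *-identityˡ y ⟨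
    1# * y           ≈⟨ *-congʳ (*-inverseʳ x≉0) ⟨
    (x * x ⁻¹) * y   ≈⟨ solve 3 (λ x i y → (x :* i) :* y := i :* (x :* y)) refl x (x ⁻¹) y ⟩
    x ⁻¹ * (x * y)   ≈⟨ *-congˡ xy≈0 ⟩
    x ⁻¹ * 0#        ≈⟨ zeroʳ (x ⁻¹) ⟩
    0#               ∎

  *-cancelˡ : ∀ {x y z} → ¬ (x ≈ 0#) → x * y ≈ x * z → y ≈ z
  *-cancelˡ {x} {y} {z} x≉0 xy≈xz = x∙y⁻¹≈ε⇒x≈y y z (*-cancel-0 x≉0 (begin
    x * (y - z)    ≈⟨ solve 3 (λ x y z → x :* (y :- z) := x :* y :- x :* z) refl x y z ⟩
    x * y - x * z  ≈⟨ x≈y⇒x∙y⁻¹≈ε xy≈xz ⟩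
    0#             ∎))

  x*y≈0⇒x≈0∨y≈0 : ∀ {x y} → x * y ≈ 0# → x ≈ 0# ⊎ y ≈ 0#
  x*y≈0⇒x≈0∨y≈0 {x} {y} xy≈0 with x ≈? 0#
  ... | yes x≈0 = inj₁ x≈0
  ... | no  x≉0 = inj₂ (*-cancel-0 x≉0 xy≈0)

  *-≉0 : ∀ {x y} → ¬ (x ≈ 0#) → ¬ (y ≈ 0#) → ¬ (x * y ≈ 0#)
  *-≉0 x≉0 y≉0 xy≈0 = y≉0 (*-cancel-0 x≉0 xy≈0)

  ^-≉0 : ∀ {x} n → ¬ (x ≈ 0#) → ¬ (x ^ n ≈ 0#)
  ^-≉0 zero    x≉0 = 1≉0
  ^-≉0 (suc n) x≉0 = *-≉0 x≉0 (^-≉0 n x≉0)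

  x*[y/x]≈y : ∀ {x} y → ¬ (x ≈ 0#) → x * (y / x) ≈ y
  x*[y/x]≈y {x} y x≉0 = begin
    x * (y * x ⁻¹)   ≈⟨ solve 3 (λ x y i → x :* (y :* i) := y :* (x :* i)) refl x y (x ⁻¹) ⟩
    y * (x * x ⁻¹)   ≈⟨ *-congˡ (*-inverseʳ x≉0) ⟩
    y * 1#           ≈⟨ *-identityʳ y ⟩
    y                ∎

  /-unique : ∀ {x y z} → ¬ (x ≈ 0#) → x * z ≈ y → z ≈ y / x
  /-unique x≉0 xz≈y = *-cancelˡ x≉0 (trans xz≈y (sym (x*[y/x]≈y _ x≉0)))

  -- The tool for deductions from polynomial equations: `k` is a cofactor exhibiting c - d as a
  -- multiple of a - b, and what remains is an identity for the ring solver. Nested uses treat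
  -- several hypotheses.
  modulo : ∀ {a b c d} k → a ≈ b → c ≈ d + k * (a - b) → c ≈ d
  modulo {a} {b} {c} {d} k a≈b c≈ = begin
    c                 ≈⟨ c≈ ⟩
    d + k * (a - b)   ≈⟨ +-congˡ (*-congˡ (x≈y⇒x∙y⁻¹≈ε a≈b)) ⟩
    d + k * 0#        ≈⟨ +-congˡ (zeroʳ k) ⟩
    d + 0#            ≈⟨ +-identityʳ d ⟩
    d                 ∎

  modulo-0 : ∀ {a c d} k → a ≈ 0# → c ≈ d + k * a → c ≈ d
  modulo-0 k a≈0 c≈ = trans c≈ (trans (+-congˡ (trans (*-congˡ a≈0) (zeroʳ k))) (+-identityʳ _))

  x-y≈0⇒x≈y : ∀ {x y} → x - y ≈ 0# → x ≈ y
  x-y≈0⇒x≈y = x∙y⁻¹≈ε⇒x≈y _ _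

  x²≈y²⇒x≈±y : ∀ {x y} → x ^ 2 ≈ y ^ 2 → x ≈ y ⊎ x ≈ - y
  x²≈y²⇒x≈±y {x} {y} x²≈y² with x*y≈0⇒x≈0∨y≈0 (begin
      (x - y) * (x - - y)  ≈⟨ solve 2 (λ x y → (x :- y) :* (x :- :- y) := x :^ 2 :- y :^ 2) refl x y ⟩
      x ^ 2 - y ^ 2        ≈⟨ x≈y⇒x∙y⁻¹≈ε x²≈y² ⟩
      0#                   ∎)
  ... | inj₁ x-y≈0 = inj₁ (x-y≈0⇒x≈y x-y≈0)
  ... | inj₂ x+y≈0 = inj₂ (x-y≈0⇒x≈y x+y≈0)

  module CubeRoots {ω} (ω²≈-ω-1 : ω * ω ≈ - 1# * ω + - 1#) where

    x³≈y³⇒x≈ωⁱy : ∀ {x y} → x ^ 3 ≈ y ^ 3 → ∃ λ i → x ≈ ω ^ i * y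
    x³≈y³⇒x≈ωⁱy {x} {y} x³≈y³ = cases (x*y≈0⇒x≈0∨y≈0 product≈0)
      where
      product≈0 : (x - ω ^ 0 * y) * ((x - ω ^ 1 * y) * (x - ω ^ 2 * y)) ≈ 0#
      product≈0 = begin
        (x - ω ^ 0 * y) * ((x - ω ^ 1 * y) * (x - ω ^ 2 * y))
          ≈⟨ modulo ((x - y) * ((ω - 1#) * y ^ 2 - x * y)) ω²≈-ω-1
             -- `ω :^ 0` evaluates to `1#`, whereas `con (+ 1)` would give the opaque `fromℤ (+ 1)`.
             -- Zeroth powers play the constant 1 in many later solver calls as well.
             (solve 3 (λ x y ω →
                (x :- ω :^ 0 :* y) :* ((x :- ω :^ 1 :* y) :* (x :- ω :^ 2 :* y))
                := x :^ 3 :- y :^ 3 :+ (x :- y) :* ((ω :- ω :^ 0) :* y :^ 2 :- x :* y) :*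
                     (ω :* ω :- ((:- ω :^ 0) :* ω :+ (:- ω :^ 0)))) refl x y ω) ⟩
        x ^ 3 - y ^ 3   ≈⟨ x≈y⇒x∙y⁻¹≈ε x³≈y³ ⟩
        0# ∎
      cases : _ → ∃ λ i → x ≈ ω ^ i * y
      cases (inj₁ e) = 0 , x-y≈0⇒x≈y e
      cases (inj₂ e) with x*y≈0⇒x≈0∨y≈0 e
      ... | inj₁ e₁ = 1 , x-y≈0⇒x≈y e₁
      ... | inj₂ e₂ = 2 , x-y≈0⇒x≈y e₂

module ClosureProperties {c ℓ c′ ℓ′} (K : NumberField c ℓ)
       (K̄ : AlgebraicClosure (NumberField.discreteField K) c′ ℓ′) where
  private
    module K = NumberField K
    module KP = FieldProperties K.discreteField
    module ℚ→K = RingMorphisms.IsRingHomomorphism (Extension.isRingHomomorphism K.rationals)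
  open AlgebraicClosure K̄
  open FieldProperties discreteField
  module E = RingMorphisms.IsRingHomomorphism isRingHomomorphism

  -- A unit stays a unit: the image of a⁻¹ inverts the image of a.
  embed-≉0 : ∀ {a} → ¬ (a K.≈ K.0#) → ¬ (embed a ≈ 0#)
  embed-≉0 {a} a≉0 e = 1≉0 (trans (sym E.1#-homo) (trans (E.⟦⟧-cong (K.sym (KP.*-inverseʳ a≉0)))
    (trans (E.*-homo a (a K.⁻¹)) (trans (*-congʳ e) (zeroˡ _)))))

  embed-injective : ∀ {a} → embed a ≈ 0# → a K.≈ K.0#
  embed-injective {a} e with a KP.≈? K.0#
  ... | yes a≈0 = a≈0
  ... | no  a≉0 = ⊥-elim (embed-≉0 a≉0 e)

  private
    -- Built by the same recursion as `n · 1#`, so that the two are compared by induction.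
    ℕ→ℚ : ℕ → ℚ.ℚ
    ℕ→ℚ zero    = ℚ.0ℚ
    ℕ→ℚ (suc n) = ℚ.1ℚ ℚ.+ ℕ→ℚ n

    ℕ→ℚ-nonNegative : ∀ n → ℚ.0ℚ ℚ.≤ ℕ→ℚ n
    ℕ→ℚ-nonNegative zero    = ℚ.≤-refl
    ℕ→ℚ-nonNegative (suc n) = ℚ.+-mono-≤ {ℚ.0ℚ} {ℚ.1ℚ} (ℚ.nonNegative⁻¹ ℚ.1ℚ) (ℕ→ℚ-nonNegative n)

    ℕ→ℚ-positive : ∀ n → ℚ.0ℚ ℚ.< ℕ→ℚ (suc n)
    ℕ→ℚ-positive n = ℚ.+-mono-<-≤ {ℚ.0ℚ} {ℚ.1ℚ} (ℚ.positive⁻¹ ℚ.1ℚ) (ℕ→ℚ-nonNegative n)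

    φ : ℚ.ℚ → Carrier
    φ q = embed (Extension.embed K.rationals q)

    φ-ℕ : ∀ n → φ (ℕ→ℚ n) ≈ n · 1#
    φ-ℕ zero    = trans (E.⟦⟧-cong ℚ→K.0#-homo) E.0#-homo
    φ-ℕ (suc n) = trans (E.⟦⟧-cong (ℚ→K.+-homo ℚ.1ℚ (ℕ→ℚ n))) (trans (E.+-homo _ _)
      (+-cong (trans (E.⟦⟧-cong ℚ→K.1#-homo) E.1#-homo) (φ-ℕ n)))

  -- The rational number n + 1 is positive, hence invertible, and the homomorphisms from ℚ to K and
  -- from K to its closure preserve the inverse.
  fromℤ-≉0 : ∀ n → ¬ (fromℤ (+ suc n) ≈ 0#)
  fromℤ-≉0 n n≈0 = 1≉0 (trans (sym E.1#-homo) (trans (sym (E.⟦⟧-cong ℚ→K.1#-homo))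
    (trans (E.⟦⟧-cong (ℚ→K.⟦⟧-cong (≡.sym (ℚ.*-inverseʳ q))))
    (trans (E.⟦⟧-cong (ℚ→K.*-homo q (ℚ.1/ q))) (trans (E.*-homo _ _)
    (trans (*-congʳ (trans (φ-ℕ (suc n)) (trans (fromℤ-· (suc n) 1#) (trans (*-congʳ n≈0) (zeroˡ 1#))))) (zeroˡ _)))))))
    where
    q = ℕ→ℚ (suc n)
    instance
      q-nonZero : ℚ.NonZero q
      q-nonZero = ℚ.>-nonZero (ℕ→ℚ-positive n)

-- The 5-torsion points of y² = x³ + c

module FiveTorsion {c ℓ c′ ℓ′} (K : NumberField c ℓ)
       (K̄ : AlgebraicClosure (NumberField.discreteField K) c′ ℓ′) where

  private module K = NumberField K
  open AlgebraicClosure K̄ hiding (zero)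
  open Setting K K̄
  open FieldProperties discreteField
  open ClosureProperties K K̄
  open ℤ-Solver hiding (⟦_⟧)
  open import Relation.Binary.Reasoning.Setoid setoid

  private
    ⟦_⟧ᵖ = ℤ-Solver.⟦_⟧

  ^-congˡ : ∀ n {x y} → x ≈ y → x ^ n ≈ y ^ n
  ^-congˡ zero    x≈y = refl
  ^-congˡ (suc n) x≈y = *-cong x≈y (^-congˡ n x≈y)

  polynomial-cong : ∀ {n} (p : Polynomial n) {ρ ρ′ : Vec Carrier n} →
    (∀ i → lookup ρ i ≈ lookup ρ′ i) → ⟦ p ⟧ᵖ ρ ≈ ⟦ p ⟧ᵖ ρ′
  polynomial-cong (op [+] p q) e = +-cong (polynomial-cong p e) (polynomial-cong q e)
  polynomial-cong (op [*] p q) e = *-cong (polynomial-cong p e) (polynomial-cong q e)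
  polynomial-cong (con z)      e = refl
  polynomial-cong (var i)      e = e i
  polynomial-cong (p :^ n)     e = ^-congˡ n (polynomial-cong p e)
  polynomial-cong (:- p)       e = -‿cong (polynomial-cong p e)

  -- The 5-division polynomial of y² = x³ + c, as a polynomial in X = x³ and c.
  ψ₅ : Carrier → Carrier → Carrier
  ψ₅ X C = fromℤ (+ 5) * X ^ 4 + fromℤ (+ 380) * X ^ 3 * C - fromℤ (+ 240) * X ^ 2 * C ^ 2
         - fromℤ (+ 1600) * X * C ^ 3 - fromℤ (+ 256) * C ^ 4

  -- The syntax of `ψ₅` for the solver; its evaluation is `ψ₅` by definition.
  ψ₅ᵖ : ∀ {n} → Polynomial n → Polynomial n → Polynomial n
  ψ₅ᵖ X C = con (+ 5) :* X :^ 4 :+ con (+ 380) :* X :^ 3 :* C :- con (+ 240) :* X :^ 2 :* C :^ 2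
         :- con (+ 1600) :* X :* C :^ 3 :- con (+ 256) :* C :^ 4

  ψ₅-congˡ : ∀ {X X′ C} → X ≈ X′ → ψ₅ X C ≈ ψ₅ X′ C
  ψ₅-congˡ {X} {X′} {C} e = polynomial-cong (ψ₅ᵖ (var zero) (var (suc zero))) {X ∷ C ∷ []} {X′ ∷ C ∷ []}
    λ { zero → e ; (suc zero) → refl }

  chord-x : (m x₁ x₂ : Carrier) → Carrier
  chord-x m x₁ x₂ = m ^ 2 - x₁ - x₂

  chord-y : (m x₁ y₁ x₂ : Carrier) → Carrier
  chord-y m x₁ y₁ x₂ = m * (x₁ - chord-x m x₁ x₂) - y₁

  -- On the line, y² - x³ - C becomes a cubic f in X, and x₃ is chosen so that f(X) + (X - x₁)(X -
  -- x₂)(X - x₃) is linear. Interpolating this linear polynomial at x₁ and x₂ gives (x₂ - x₁) f(x₃)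
  -- = (x₂ - x₃) f(x₁) + (x₃ - x₁) f(x₂), where f(x₁) and f(x₂) vanish.
  chord-on-curve : ∀ {C m x₁ y₁ x₂ y₂} → ¬ (x₂ - x₁ ≈ 0#) →
    y₁ ^ 2 ≈ x₁ ^ 3 + C → y₂ ^ 2 ≈ x₂ ^ 3 + C → (x₂ - x₁) * m ≈ y₂ - y₁ →
    chord-y m x₁ y₁ x₂ ^ 2 ≈ chord-x m x₁ x₂ ^ 3 + C
  chord-on-curve {C} {m} {x₁} {y₁} {x₂} {y₂} d≉0 on₁ on₂ slope = *-cancelˡ d≉0
    (modulo (x₂ - x₃) on₁ (trans
      (modulo (x₃ - x₁) on₂′ (solve 5 (λ x₁ y₁ x₂ m C →
        let x₃ = m :^ 2 :- x₁ :- x₂ ; y₃ = m :* (x₁ :- x₃) :- y₁ in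
        (x₂ :- x₁) :* y₃ :^ 2
        := (x₂ :- x₁) :* (x₃ :^ 3 :+ C) :+ (x₂ :- x₃) :* (y₁ :^ 2 :- (x₁ :^ 3 :+ C))
          :+ (x₃ :- x₁) :* (((x₂ :- x₁) :* m :+ y₁) :^ 2 :- (x₂ :^ 3 :+ C)))
        refl x₁ y₁ x₂ m C))
      refl))
    where
    x₃ = chord-x m x₁ x₂
    on₂′ : ((x₂ - x₁) * m + y₁) ^ 2 ≈ x₂ ^ 3 + C
    on₂′ = trans (^-congˡ 2 (trans (+-congʳ slope)
      (solve 2 (λ y₁ y₂ → (y₂ :- y₁) :+ y₁ := y₂) refl y₁ y₂))) on₂

  tangent-slope : (x y : Carrier) → Carrier
  tangent-slope x y = (3 · x ^ 2) / (2 · y)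

  tangent-slope-* : ∀ {x y} → ¬ (y ≈ 0#) →
    fromℤ (+ 2) * y * tangent-slope x y ≈ fromℤ (+ 3) * x ^ 2
  tangent-slope-* {x} {y} y≉0 = begin
    fromℤ (+ 2) * y * tangent-slope x y  ≈⟨ *-congʳ (fromℤ-· 2 y) ⟨
    2 · y * tangent-slope x y            ≈⟨ x*[y/x]≈y (3 · x ^ 2) (λ 2y≈0 →
                                              *-≉0 (fromℤ-≉0 1) y≉0 (trans (sym (fromℤ-· 2 y)) 2y≈0)) ⟩
    3 · x ^ 2                            ≈⟨ fromℤ-· 3 (x ^ 2) ⟩
    fromℤ (+ 3) * x ^ 2                  ∎

  -- The graph of adding a fixed affine point, one constructor per branch of `_⊕_`. Matching on it
  -- reveals the shape of the sum and the reason for the branch, and keeps the slope a variable with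
  -- a defining equation instead of a quotient.
  data Addition (x₁ y₁ : Carrier) : Point → Point → Set (c′ ⊔ ℓ′) where
    identity : Addition x₁ y₁ 𝒪 (aff x₁ y₁)
    secant : ∀ {x₂ y₂} m → ¬ (x₂ - x₁ ≈ 0#) → (x₂ - x₁) * m ≈ y₂ - y₁ →
      Addition x₁ y₁ (aff x₂ y₂) (aff (chord-x m x₁ x₂) (chord-y m x₁ y₁ x₂))
    tangent : ∀ {x₂ y₂} m → m ≡ tangent-slope x₁ y₁ → x₁ ≈ x₂ → ¬ (y₁ + y₂ ≈ 0#) →
      Addition x₁ y₁ (aff x₂ y₂) (aff (chord-x m x₁ x₂) (chord-y m x₁ y₁ x₂))
    opposite : ∀ {x₂ y₂} → x₁ ≈ x₂ → y₁ + y₂ ≈ 0# → Addition x₁ y₁ (aff x₂ y₂) 𝒪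

  addition : ∀ x₁ y₁ Q → Addition x₁ y₁ Q (aff x₁ y₁ ⊕ Q)
  addition x₁ y₁ 𝒪 = identity
  addition x₁ y₁ (aff x₂ y₂) with x₁ #? x₂ | (y₁ + y₂) #? 0#
  ... | yes x₁#x₂ | _ = secant _ d≉0 (x*[y/x]≈y (y₂ - y₁) d≉0)
    where
    d≉0 : ¬ (x₂ - x₁ ≈ 0#)
    d≉0 d≈0 = #⇒≉ x₁#x₂ (sym (x-y≈0⇒x≈y d≈0))
  ... | no ¬x₁#x₂ | yes y₁+y₂#0 = tangent _ ≡.refl (proj₁ (tight _ _) ¬x₁#x₂) (#⇒≉ y₁+y₂#0)
  ... | no ¬x₁#x₂ | no ¬y₁+y₂#0 = opposite (proj₁ (tight _ _) ¬x₁#x₂) (proj₁ (tight _ _) ¬y₁+y₂#0)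

  addition-Is𝒪 : ∀ {x₁ y₁ x₂ y₂ R} → Addition x₁ y₁ (aff x₂ y₂) R → Is𝒪 R → x₁ ≈ x₂ × y₁ + y₂ ≈ 0#
  addition-Is𝒪 (secant _ _ _)           ()
  addition-Is𝒪 (tangent _ _ _ _)        ()
  addition-Is𝒪 (opposite x₁≈x₂ y₁+y₂≈0) _ = x₁≈x₂ , y₁+y₂≈0

  Is𝒪-addition : ∀ {x₁ y₁ x₂ y₂ R} → Addition x₁ y₁ (aff x₂ y₂) R → x₁ ≈ x₂ → y₁ + y₂ ≈ 0# → Is𝒪 R
  Is𝒪-addition (secant _ x₂-x₁≉0 _)    x₁≈x₂ _       = ⊥-elim (x₂-x₁≉0 (x≈y⇒x∙y⁻¹≈ε (sym x₁≈x₂)))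
  Is𝒪-addition (tangent _ _ _ y₁+y₂≉0) _     y₁+y₂≈0 = ⊥-elim (y₁+y₂≉0 y₁+y₂≈0)
  Is𝒪-addition (opposite _ _)          _     _       = tt

  -- A point P = (x , y) with y ≠ 0, the slope m of the tangent at P and 2P = (x₂ , y₂).
  module Doubling {C x y} (on : y ^ 2 ≈ x ^ 3 + C) (m : Carrier)
    (slope : fromℤ (+ 2) * y * m ≈ fromℤ (+ 3) * x ^ 2) where

    x₂ y₂ : Carrier
    x₂ = chord-x m x x
    y₂ = chord-y m x y x

    double-on-curve : y₂ ^ 2 ≈ x₂ ^ 3 + C
    double-on-curve = modulo 1# on (trans (modulo (x₂ - x) slope
      (solve 4 (λ x y m C →
        let x₂ = m :^ 2 :- x :- x ; y₂ = m :* (x :- x₂) :- y in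
        y₂ :^ 2 := (x₂ :^ 3 :+ C :+ x :^ 0 :* (y :^ 2 :- (x :^ 3 :+ C)))
          :+ (x₂ :- x) :* (con (+ 2) :* y :* m :- con (+ 3) :* x :^ 2)) refl x y m C)) refl)

    -- The condition 3P = - 2P reads (y₂ - y)² = (x + 2x₂) (x₂ - x)².
    tripling : fromℤ (+ 64) * y ^ 6 * ((y₂ - y) ^ 2 - (x + x₂ + x₂) * (x₂ - x) ^ 2) ≈ - ψ₅ (x ^ 3) C
    tripling = begin
      fromℤ (+ 64) * y ^ 6 * ((y₂ - y) ^ 2 - (x + x₂ + x₂) * (x₂ - x) ^ 2)
        ≈⟨ solve 3 (λ x y m →
             let x₂ = m :^ 2 :- x :- x ; y₂ = m :* (x :- x₂) :- y in
             con (+ 64) :* y :^ 6 :* ((y₂ :- y) :^ 2 :- (x :+ x₂ :+ x₂) :* (x₂ :- x) :^ 2)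
             := G x (y :^ 2) (con (+ 2) :* y :* m)) refl x y m ⟩
      ⟦ G (var zero) (var (suc zero)) (var (suc (suc zero))) ⟧ᵖ (x ∷ y ^ 2 ∷ fromℤ (+ 2) * y * m ∷ [])
        ≈⟨ polynomial-cong (G (var zero) (var (suc zero)) (var (suc (suc zero))))
             {_ ∷ _ ∷ _ ∷ []} {_ ∷ _ ∷ _ ∷ []}
             (λ { zero → refl ; (suc zero) → on ; (suc (suc zero)) → slope }) ⟩
      ⟦ G (var zero) (var (suc zero)) (var (suc (suc zero))) ⟧ᵖ (x ∷ x ^ 3 + C ∷ fromℤ (+ 3) * x ^ 2 ∷ [])
        ≈⟨ solve 2 (λ x C → G x (x :^ 3 :+ C) (con (+ 3) :* x :^ 2) := :- ψ₅ᵖ (x :^ 3) C) refl x C ⟩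
      - ψ₅ (x ^ 3) C ∎
      where
      -- The left side expressed through x, Y = y² and z = 2ym alone, so that the curve equation and
      -- the slope equation can be substituted for Y and z. It uses 4Y(x₂ - x) = z² - 12xY and
      -- 8y³(y₂ - y) = z(12xY - z²) - 16Y².
      G : ∀ {n} → Polynomial n → Polynomial n → Polynomial n → Polynomial n
      G x Y z = (z :* (con (+ 12) :* x :* Y :- z :^ 2) :- con (+ 16) :* Y :^ 2) :^ 2
        :- (con (+ 2) :* z :^ 2 :- con (+ 12) :* x :* Y) :* (z :^ 2 :- con (+ 12) :* x :* Y) :^ 2

    double-+ : y + y₂ ≈ m * (x - x₂)
    double-+ = solve 2 (λ y z → y :+ (z :- y) := z) refl y (m * (x - x₂))

    module Tripling (m′ : Carrier) (x₂-x≉0 : ¬ (x₂ - x ≈ 0#)) (slope′ : (x₂ - x) * m′ ≈ y₂ - y) where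

      x₃ y₃ : Carrier
      x₃ = chord-x m′ x x₂
      y₃ = chord-y m′ x y x₂

      triple-on-curve : y₃ ^ 2 ≈ x₃ ^ 3 + C
      triple-on-curve = chord-on-curve x₂-x≉0 on double-on-curve slope′

      ψ₅≈0⇒x₃≈x₂ : ψ₅ (x ^ 3) C ≈ 0# → ¬ (y ≈ 0#) → x₃ ≈ x₂
      ψ₅≈0⇒x₃≈x₂ ψ≈0 y≉0 = x-y≈0⇒x≈y (*-cancel-0 (^-≉0 2 x₂-x≉0) (begin
        (x₂ - x) ^ 2 * (x₃ - x₂)
          ≈⟨ solve 3 (λ x x₂ m′ → (x₂ :- x) :^ 2 :* (m′ :^ 2 :- x :- x₂ :- x₂)
               := ((x₂ :- x) :* m′) :^ 2 :- (x :+ x₂ :+ x₂) :* (x₂ :- x) :^ 2) refl x x₂ m′ ⟩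
        ((x₂ - x) * m′) ^ 2 - (x + x₂ + x₂) * (x₂ - x) ^ 2
          ≈⟨ +-congʳ (^-congˡ 2 slope′) ⟩
        (y₂ - y) ^ 2 - (x + x₂ + x₂) * (x₂ - x) ^ 2
          ≈⟨ *-cancel-0 (*-≉0 (fromℤ-≉0 63) (^-≉0 6 y≉0))
               (trans tripling (trans (-‿cong ψ≈0) -0#≈0#)) ⟩
        0# ∎))

      x₃≈x₂⇒ψ₅≈0 : x₃ ≈ x₂ → ψ₅ (x ^ 3) C ≈ 0#
      x₃≈x₂⇒ψ₅≈0 x₃≈x₂ = begin
        ψ₅ (x ^ 3) C       ≈⟨ solve 1 (λ z → z := :- :- z) refl (ψ₅ (x ^ 3) C) ⟩
        - - ψ₅ (x ^ 3) C   ≈⟨ -‿cong tripling ⟨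
        - (fromℤ (+ 64) * y ^ 6 * ((y₂ - y) ^ 2 - (x + x₂ + x₂) * (x₂ - x) ^ 2))
          ≈⟨ -‿cong (*-congˡ (+-congʳ (^-congˡ 2 slope′))) ⟨
        - (fromℤ (+ 64) * y ^ 6 * (((x₂ - x) * m′) ^ 2 - (x + x₂ + x₂) * (x₂ - x) ^ 2))
          ≈⟨ solve 4 (λ x x₂ m′ k → :- (k :* (((x₂ :- x) :* m′) :^ 2 :- (x :+ x₂ :+ x₂) :* (x₂ :- x) :^ 2))
               := :- (k :* (x₂ :- x) :^ 2) :* (m′ :^ 2 :- x :- x₂ :- x₂)) refl x x₂ m′ (fromℤ (+ 64) * y ^ 6) ⟩
        - (fromℤ (+ 64) * y ^ 6 * (x₂ - x) ^ 2) * (x₃ - x₂)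
          ≈⟨ *-congˡ (x≈y⇒x∙y⁻¹≈ε x₃≈x₂) ⟩
        - (fromℤ (+ 64) * y ^ 6 * (x₂ - x) ^ 2) * 0#   ≈⟨ zeroʳ _ ⟩
        0# ∎

      -- If P + 3P = ± P, the line through P and 3P is tangent at P, so 3P = ± 2P.
      quadrupling : ¬ (y ≈ 0#) → ∀ m″ → ¬ (x₃ - x ≈ 0#) → (x₃ - x) * m″ ≈ y₃ - y →
        x ≈ chord-x m″ x x₃ → x₃ ≈ x₂
      quadrupling y≉0 m″ x₃-x≉0 slope″ x≈x₄ = begin
        x₃               ≈⟨ modulo 1# x≈x₄ (solve 3 (λ x x₃ m″ →
                              x₃ := m″ :^ 2 :- x :- x :+ x :^ 0 :* (x :- (m″ :^ 2 :- x :- x₃))) refl x x₃ m″) ⟩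
        m″ ^ 2 - x - x   ≈⟨ +-congʳ (+-congʳ (^-congˡ 2 m″≈m)) ⟩
        x₂               ∎
        where
        y₃≈ : y + (x₃ - x) * m″ ≈ y₃
        y₃≈ = trans (+-congˡ slope″) (solve 2 (λ y y₃ → y :+ (y₃ :- y) := y₃) refl y y₃)
        on₃ : (y + (x₃ - x) * m″) ^ 2 ≈ x₃ ^ 3 + C
        on₃ = trans (^-congˡ 2 y₃≈) triple-on-curve
        m″≈m : m″ ≈ m
        m″≈m = *-cancelˡ (*-≉0 (fromℤ-≉0 1) y≉0) (trans (*-cancelˡ x₃-x≉0
          (modulo 1# on₃ (trans (modulo (- 1#) on (trans (modulo ((x₃ - x) ^ 2) x≈x₄
            (solve 5 (λ x y x₃ m″ C → (x₃ :- x) :* (con (+ 2) :* y :* m″)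
              := (((x₃ :- x) :* (con (+ 3) :* x :^ 2)
                :+ x :^ 0 :* ((y :+ (x₃ :- x) :* m″) :^ 2 :- (x₃ :^ 3 :+ C)))
                :+ (:- x :^ 0) :* (y :^ 2 :- (x :^ 3 :+ C)))
                :+ (x₃ :- x) :^ 2 :* (x :- (m″ :^ 2 :- x :- x₃))) refl x y x₃ m″ C)) refl)) refl)))
          (sym slope))

  module _ (c₀ : K.Carrier) (c₀≉0 : ¬ (c₀ K.≈ K.0#)) where
    private
      C : Carrier
      C = embed c₀
      C≉0 : ¬ (C ≈ 0#)
      C≉0 = embed-≉0 c₀≉0

    -- P₂ to P₅ are variables for the successive sums, so that each match on an `Addition` can
    -- refine them. The degenerate branches are contradictory; in the generic one 4P has the
    -- x-coordinate of P, which `quadrupling` turns into x₃ ≈ x₂.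
    5-torsion⇒ψ₅≈0 : ∀ {x y} → Torsion 5 c₀ (aff x y) → ψ₅ (x ^ 3) C ≈ 0#
    5-torsion⇒ψ₅≈0 {x} {y} (on , 5P≈𝒪) =
      multiples (addition x y _) (addition x y _) (addition x y _) (addition x y _) 5P≈𝒪
      where
      multiples : ∀ {P₂ P₃ P₄ P₅} → Addition x y (aff x y) P₂ → Addition x y P₂ P₃ →
        Addition x y P₃ P₄ → Addition x y P₄ P₅ → Is𝒪 P₅ → ψ₅ (x ^ 3) C ≈ 0#
      multiples (secant _ x-x≉0 _) _ _ _ _ = ⊥-elim (x-x≉0 (-‿inverseʳ x))
      multiples (opposite _ 2y≈0) identity P₄ P₅ 5P≈𝒪 = ⊥-elim (P₄-cases P₄ P₅ 5P≈𝒪)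
        where
        P₄-cases : ∀ {P₄ P₅} → Addition x y (aff x y) P₄ → Addition x y P₄ P₅ → Is𝒪 P₅ → ⊥
        P₄-cases (secant _ x-x≉0 _)    _ _ = x-x≉0 (-‿inverseʳ x)
        P₄-cases (tangent _ _ _ 2y≉0)  _ _ = 2y≉0 2y≈0
        P₄-cases (opposite _ _) identity ()
      multiples (tangent m m≡ _ 2y≉0) P₃ P₄ P₅ 5P≈𝒪 = P₃-cases P₃ P₄ P₅ 5P≈𝒪
        where
        y≉0 : ¬ (y ≈ 0#)
        y≉0 y≈0 = 2y≉0 (trans (+-cong y≈0 y≈0) (+-identityˡ 0#))
        slope : fromℤ (+ 2) * y * m ≈ fromℤ (+ 3) * x ^ 2
        slope = trans (*-congˡ (reflexive m≡)) (tangent-slope-* y≉0)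
        open Doubling on m slope
        P₃-cases : ∀ {P₃ P₄ P₅} → Addition x y (aff x₂ y₂) P₃ →
          Addition x y P₃ P₄ → Addition x y P₄ P₅ → Is𝒪 P₅ → ψ₅ (x ^ 3) C ≈ 0#
        P₃-cases (opposite _ _) identity P₅ 5P≈𝒪 = ⊥-elim (2y≉0 (proj₂ (addition-Is𝒪 P₅ 5P≈𝒪)))
        P₃-cases (tangent _ _ x≈x₂ y+y₂≉0) _ _ _ = ⊥-elim (y+y₂≉0
          (trans double-+ (trans (*-congˡ (x≈y⇒x∙y⁻¹≈ε x≈x₂)) (zeroʳ m))))
        P₃-cases (secant m′ x₂-x≉0 slope′) P₄ P₅ 5P≈𝒪 = P₄-cases P₄ P₅ 5P≈𝒪
          where
          open Tripling m′ x₂-x≉0 slope′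
          P₄-cases : ∀ {P₄ P₅} → Addition x y (aff x₃ y₃) P₄ → Addition x y P₄ P₅ → Is𝒪 P₅ → ψ₅ (x ^ 3) C ≈ 0#
          P₄-cases (opposite _ _) identity ()
          -- As 3P has x-coordinate x, adding P along the tangent gives 4P the x-coordinate of 2P;
          -- 5P = 𝒪 would make it equal to x.
          P₄-cases (tangent _ ≡.refl x≈x₃ _) P₅ 5P≈𝒪 = ⊥-elim (x₂-x≉0 (x≈y⇒x∙y⁻¹≈ε (begin
            x₂   ≈⟨ +-cong (+-congʳ (^-congˡ 2 (reflexive m≡))) (-‿cong x≈x₃) ⟩
            _    ≈⟨ proj₁ (addition-Is𝒪 P₅ 5P≈𝒪) ⟨
            x    ∎)))
          P₄-cases (secant m″ x₃-x≉0 slope″) P₅ 5P≈𝒪 =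
            x₃≈x₂⇒ψ₅≈0 (quadrupling y≉0 m″ x₃-x≉0 slope″ (proj₁ (addition-Is𝒪 P₅ 5P≈𝒪)))

    -- Applied at k = 0, -1 and -4, where kC is the x³ of points of order 3, 2 and 3. The values of
    -- `ψ₅` there are -2⁸C⁴, 3⁶C⁴ and -2⁸3⁴C⁴, nonzero in characteristic zero.
    ψ₅-root-≉ : ∀ {X} k n → (∀ C → ψ₅ (k * C) C ≈ fromℤ n * C ^ 4) → ¬ (fromℤ n ≈ 0#) →
      ψ₅ X C ≈ 0# → ¬ (X ≈ k * C)
    ψ₅-root-≉ k n value n≉0 ψ≈0 X≈kC =
      *-≉0 n≉0 (^-≉0 4 C≉0) (trans (sym (value C)) (trans (sym (ψ₅-congˡ X≈kC)) ψ≈0))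

    fromℤ-neg-≉0 : ∀ n → ¬ (fromℤ -[1+ n ] ≈ 0#)
    fromℤ-neg-≉0 n e = fromℤ-≉0 n (trans (fromℤ-neg -[1+ n ]) (trans (-‿cong e) -0#≈0#))

    ψ₅-root-≉0 : ∀ {x} → ψ₅ (x ^ 3) C ≈ 0# → ¬ (x ≈ 0#)
    ψ₅-root-≉0 {x} ψ≈0 x≈0 = ψ₅-root-≉ (fromℤ (+ 0)) -[1+ 255 ]
      (solve 1 (λ C → ψ₅ᵖ (con (+ 0) :* C) C := con -[1+ 255 ] :* C :^ 4) refl)
      (fromℤ-neg-≉0 255) ψ≈0
      (trans (trans (*-congʳ x≈0) (zeroˡ _)) (sym (trans (*-congʳ fromℤ-0) (zeroˡ C))))

    ψ₅-root-X≉-C : ∀ {X} → ψ₅ X C ≈ 0# → ¬ (X ≈ fromℤ -[1+ 0 ] * C)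
    ψ₅-root-X≉-C = ψ₅-root-≉ (fromℤ -[1+ 0 ]) (+ 729)
      (solve 1 (λ C → ψ₅ᵖ (con -[1+ 0 ] :* C) C := con (+ 729) :* C :^ 4) refl)
      (fromℤ-≉0 728)

    ψ₅-root-X≉-4C : ∀ {X} → ψ₅ X C ≈ 0# → ¬ (X ≈ fromℤ -[1+ 3 ] * C)
    ψ₅-root-X≉-4C = ψ₅-root-≉ (fromℤ -[1+ 3 ]) -[1+ 20735 ]
      (solve 1 (λ C → ψ₅ᵖ (con -[1+ 3 ] :* C) C := con -[1+ 20735 ] :* C :^ 4) refl)
      (fromℤ-neg-≉0 20735)

    ψ₅-root-y≉0 : ∀ {x y} → y ^ 2 ≈ x ^ 3 + C → ψ₅ (x ^ 3) C ≈ 0# → ¬ (y ≈ 0#)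
    ψ₅-root-y≉0 {x} {y} on ψ≈0 y≈0 = ψ₅-root-X≉-C ψ≈0 (begin
      x ^ 3                          ≈⟨ solve 2 (λ X C → X := (X :+ C) :+ con -[1+ 0 ] :* C) refl (x ^ 3) C ⟩
      (x ^ 3 + C) + fromℤ -[1+ 0 ] * C   ≈⟨ +-congʳ on ⟨
      y ^ 2 + fromℤ -[1+ 0 ] * C     ≈⟨ +-congʳ (trans (*-congʳ y≈0) (zeroˡ _)) ⟩
      0# + fromℤ -[1+ 0 ] * C        ≈⟨ +-identityˡ _ ⟩
      fromℤ -[1+ 0 ] * C             ∎)

    -- A root of `ψ₅` avoids the points of order 2 and 3, so 2P comes from a tangent and 3P from a
    -- secant. Then 3P = -2P, and the line through P and -2P is again the tangent at P, which gives
    -- 4P = -P.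
    ψ₅≈0⇒5-torsion : ∀ {x y} → OnCurve c₀ (aff x y) → ψ₅ (x ^ 3) C ≈ 0# → Torsion 5 c₀ (aff x y)
    ψ₅≈0⇒5-torsion {x} {y} on ψ≈0 = on ,
      multiples (addition x y _) (addition x y _) (addition x y _) (addition x y _)
      where
      y≉0 : ¬ (y ≈ 0#)
      y≉0 = ψ₅-root-y≉0 on ψ≈0
      multiples : ∀ {P₂ P₃ P₄ P₅} → Addition x y (aff x y) P₂ → Addition x y P₂ P₃ →
        Addition x y P₃ P₄ → Addition x y P₄ P₅ → Is𝒪 P₅
      multiples (secant _ x-x≉0 _) _ _ _ = ⊥-elim (x-x≉0 (-‿inverseʳ x))
      multiples (opposite _ 2y≈0) _ _ _ = ⊥-elim (*-≉0 (fromℤ-≉0 1) y≉0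
        (trans (solve 1 (λ y → con (+ 2) :* y := y :+ y) refl y) 2y≈0))
      multiples (tangent m m≡ _ _) P₃ P₄ P₅ = P₃-cases P₃ P₄ P₅
        where
        slope : fromℤ (+ 2) * y * m ≈ fromℤ (+ 3) * x ^ 2
        slope = trans (*-congˡ (reflexive m≡)) (tangent-slope-* y≉0)
        open Doubling on m slope
        x≉x₂ : ¬ (x ≈ x₂)
        -- 4y²(x - x₂) equals the 3-division polynomial 3x(x³ + 4C), and neither of its factors
        -- vanishes at a root of `ψ₅`.
        x≉x₂ x≈x₂ = *-≉0 (*-≉0 (fromℤ-≉0 2) (ψ₅-root-≉0 ψ≈0)) x³+4C≉0 (begin
            fromℤ (+ 3) * x * (x ^ 3 - fromℤ -[1+ 3 ] * C)
              ≈⟨ modulo (- (fromℤ (+ 12) * x)) on (trans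
                   (modulo (fromℤ (+ 2) * y * m + fromℤ (+ 3) * x ^ 2) slope
                     (solve 4 (λ x y m C → con (+ 3) :* x :* (x :^ 3 :- con -[1+ 3 ] :* C)
                       := ((con (+ 4) :* y :^ 2 :* (x :- (m :^ 2 :- x :- x)))
                         :+ (:- (con (+ 12) :* x)) :* (y :^ 2 :- (x :^ 3 :+ C)))
                         :+ (con (+ 2) :* y :* m :+ con (+ 3) :* x :^ 2)
                            :* (con (+ 2) :* y :* m :- con (+ 3) :* x :^ 2)) refl x y m C)) refl) ⟩
            fromℤ (+ 4) * y ^ 2 * (x - x₂)   ≈⟨ *-congˡ (x≈y⇒x∙y⁻¹≈ε x≈x₂) ⟩
            fromℤ (+ 4) * y ^ 2 * 0#         ≈⟨ zeroʳ _ ⟩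
            0#                               ∎)
          where
          x³+4C≉0 : ¬ (x ^ 3 - fromℤ -[1+ 3 ] * C ≈ 0#)
          x³+4C≉0 e = ψ₅-root-X≉-4C ψ≈0 (x-y≈0⇒x≈y e)
        P₃-cases : ∀ {P₃ P₄ P₅} → Addition x y (aff x₂ y₂) P₃ →
          Addition x y P₃ P₄ → Addition x y P₄ P₅ → Is𝒪 P₅
        P₃-cases (opposite x≈x₂ _)    _ _ = ⊥-elim (x≉x₂ x≈x₂)
        P₃-cases (tangent _ _ x≈x₂ _) _ _ = ⊥-elim (x≉x₂ x≈x₂)
        P₃-cases (secant m′ x₂-x≉0 slope′) P₄ P₅ = P₄-cases P₄ P₅
          where
          open Tripling m′ x₂-x≉0 slope′
          x₃≈x₂ : x₃ ≈ x₂
          x₃≈x₂ = ψ₅≈0⇒x₃≈x₂ ψ≈0 y≉0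
          y₃≈-y₂ : y₃ ≈ - y₂
          y₃≈-y₂ = modulo (- 1#) slope′ (trans (+-congʳ (*-congˡ (+-congˡ (-‿cong x₃≈x₂))))
            (solve 5 (λ x y x₂ y₂ m′ → m′ :* (x :- x₂) :- y
              := :- y₂ :+ (:- x :^ 0) :* ((x₂ :- x) :* m′ :- (y₂ :- y))) refl x y x₂ y₂ m′))
          P₄-cases : ∀ {P₄ P₅} → Addition x y (aff x₃ y₃) P₄ → Addition x y P₄ P₅ → Is𝒪 P₅
          P₄-cases (opposite x≈x₃ _)    _ = ⊥-elim (x≉x₂ (trans x≈x₃ x₃≈x₂))
          P₄-cases (tangent _ _ x≈x₃ _) _ = ⊥-elim (x≉x₂ (trans x≈x₃ x₃≈x₂))
          P₄-cases (secant m″ _ slope″) P₅ = Is𝒪-addition P₅ x≈x₄ (begin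
              y + (m″ * (x - chord-x m″ x x₃) - y)   ≈⟨ solve 2 (λ y z → y :+ (z :- y) := z) refl y _ ⟩
              m″ * (x - chord-x m″ x x₃)             ≈⟨ *-congˡ (x≈y⇒x∙y⁻¹≈ε x≈x₄) ⟩
              m″ * 0#                                ≈⟨ zeroʳ m″ ⟩
              0#                                     ∎)
            where
            m″≈m : m″ ≈ m
            m″≈m = *-cancelˡ x₂-x≉0 (begin
              (x₂ - x) * m″    ≈⟨ *-congʳ (+-congʳ x₃≈x₂) ⟨
              (x₃ - x) * m″    ≈⟨ slope″ ⟩
              y₃ - y           ≈⟨ +-congʳ y₃≈-y₂ ⟩
              - y₂ - y         ≈⟨ solve 4 (λ x y x₂ m → :- (m :* (x :- x₂) :- y) :- y := (x₂ :- x) :* m) refl x y x₂ m ⟩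
              (x₂ - x) * m     ∎)
            x≈x₄ : x ≈ chord-x m″ x x₃
            x≈x₄ = begin
              x                 ≈⟨ solve 2 (λ x m → x := m :^ 2 :- x :- (m :^ 2 :- x :- x)) refl x m ⟩
              m ^ 2 - x - x₂    ≈⟨ +-cong (+-congʳ (^-congˡ 2 m″≈m)) (-‿cong x₃≈x₂) ⟨
              m″ ^ 2 - x - x₃   ∎

-- Degrees of quadratic and pure cubic extensions

-- Defined through `does`, so that `falses (map′ f g P?)` and `falses P?` agree by definition and a
-- decision can be moved to an equal field without touching the exponent.
falses : ∀ {a} {P : Set a} → Dec P → ℕ
falses P? = if does P? then 0 else 1

module Subfields {c ℓ c′ ℓ′} (K : NumberField c ℓ)
       (K̄ : AlgebraicClosure (NumberField.discreteField K) c′ ℓ′) where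
  private
    module K = NumberField K
    module KP = FieldProperties K.discreteField
  open AlgebraicClosure K̄ hiding (zero)
  open Setting K K̄ renaming
    (base to ⟮base⟯; gen to ⟮gen⟯; add to ⟮add⟯; neg to ⟮neg⟯; mul to ⟮mul⟯; inv to ⟮inv⟯; resp to ⟮resp⟯)
  open Membership setoid using (_∈_)
  open FieldProperties discreteField
  open ClosureProperties K K̄
  open ℤ-Solver
  open SemiringSum semiring using (sum-cong-≋; *-distribʳ-sum)
  open import Relation.Binary.Reasoning.Setoid setoid

  -- Subfields of the closure as predicates, and the tower law

  record IsSubfield {p} (F : Pred Carrier p) : Set (c ⊔ c′ ⊔ ℓ′ ⊔ p) where
    field
      base : ∀ a → F (embed a)
      add  : ∀ {x y} → F x → F y → F (x + y)
      neg  : ∀ {x} → F x → F (- x)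
      mul  : ∀ {x y} → F x → F y → F (x * y)
      inv  : ∀ {x} → ¬ (x ≈ 0#) → F x → F (x ⁻¹)
      resp : ∀ {x y} → x ≈ y → F x → F y

    0∈ : F 0#
    0∈ = resp E.0#-homo (base K.0#)

    1∈ : F 1#
    1∈ = resp E.1#-homo (base K.1#)

    sub : ∀ {x y} → F x → F y → F (x - y)
    sub Fx Fy = add Fx (neg Fy)

    div : ∀ {x y} → ¬ (y ≈ 0#) → F x → F y → F (x / y)
    div y≉0 Fx Fy = mul Fx (inv y≉0 Fy)

    pow : ∀ n {x} → F x → F (x ^ n)
    pow zero    Fx = 1∈
    pow (suc n) Fx = mul Fx (pow n Fx)

    natural : ∀ n → F (fromℤ (+ n))
    natural n = resp (trans (fromℤ-· n 1#) (*-identityʳ _)) (multiple n)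
      where
      multiple : ∀ n → F (n · 1#)
      multiple zero    = 0∈
      multiple (suc n) = add 1∈ (multiple n)

    integer : ∀ i → F (fromℤ i)
    integer (+ n)    = natural n
    integer -[1+ n ] = resp (sym (fromℤ-neg (+ suc n))) (neg (natural (suc n)))

    sum∈ : ∀ {n} (f : Fin n → Carrier) → (∀ i → F (f i)) → F (sum f)
    sum∈ {zero}  f F-f = 0∈
    sum∈ {suc n} f F-f = add (F-f zero) (sum∈ (f ∘ suc) (F-f ∘ suc))

  K⟮⟯-isSubfield : ∀ {S : Pred Carrier (c′ ⊔ ℓ′)} → IsSubfield K⟮ S ⟯
  K⟮⟯-isSubfield = record
    { base = ⟮base⟯ ; add = ⟮add⟯ ; neg = ⟮neg⟯ ; mul = ⟮mul⟯ ; inv = ⟮inv⟯ ; resp = ⟮resp⟯ }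

  K⟮⟯-least : ∀ {p} {S : Pred Carrier (c′ ⊔ ℓ′)} {F : Pred Carrier p} →
    IsSubfield F → S ⊆ F → K⟮ S ⟯ ⊆ F
  K⟮⟯-least {F = F} isSubfield S⊆F = least
    where
    module F = IsSubfield isSubfield
    least : ∀ {x} → K⟮ _ ⟯ x → F x
    least (⟮base⟯ a)      = F.base a
    least (⟮gen⟯ Sx)      = S⊆F Sx
    least (⟮add⟯ x∈ y∈)   = F.add (least x∈) (least y∈)
    least (⟮neg⟯ x∈)      = F.neg (least x∈)
    least (⟮mul⟯ x∈ y∈)   = F.mul (least x∈) (least y∈)
    least (⟮inv⟯ x≉0 x∈)  = F.inv x≉0 (least x∈)
    least (⟮resp⟯ x≈y x∈) = F.resp x≈y (least x∈)

  InK-isSubfield : IsSubfield InK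
  InK-isSubfield = record
    { base = λ a → image a refl
    ; add  = λ { (image a x≈a) (image b y≈b) → image (a K.+ b) (trans (+-cong x≈a y≈b) (sym (E.+-homo a b))) }
    ; neg  = λ { (image a x≈a) → image (K.- a) (trans (-‿cong x≈a) (sym (E.-‿homo a))) }
    ; mul  = λ { (image a x≈a) (image b y≈b) → image (a K.* b) (trans (*-cong x≈a y≈b) (sym (E.*-homo a b))) }
    ; inv  = λ { {x} x≉0 (image a x≈a) → image (a K.⁻¹) (*-cancelˡ x≉0 (begin
        x * x ⁻¹                 ≈⟨ *-inverseʳ x≉0 ⟩
        1#                       ≈⟨ E.1#-homo ⟨
        embed K.1#               ≈⟨ E.⟦⟧-cong (KP.*-inverseʳ (λ a≈0 →
                                      x≉0 (trans x≈a (trans (E.⟦⟧-cong a≈0) E.0#-homo)))) ⟨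
        embed (a K.* a K.⁻¹)     ≈⟨ E.*-homo a (a K.⁻¹) ⟩
        embed a * embed (a K.⁻¹) ≈⟨ *-congʳ x≈a ⟨
        x * embed (a K.⁻¹)       ∎)) }
    ; resp = λ { x≈y (image a x≈a) → image a (trans (sym x≈y) x≈a) }
    }

  HasDegree-resp : ∀ {p q d} {P : Pred Carrier p} {Q : Pred Carrier q} →
    P ⊆ Q → Q ⊆ P → HasDegree P d → HasDegree Q d
  HasDegree-resp P⊆Q Q⊆P (e , e∈ , spans , independent) =
    e , (λ i → P⊆Q (e∈ i)) , (λ x Qx → spans x (Q⊆P Qx)) , independent

  InK-degree : HasDegree InK 1
  InK-degree = (λ _ → 1#) , (λ _ → image K.1# (sym E.1#-homo))
    , (λ { x (image a x≈a) → (λ _ → a) , trans x≈a (sym (single (λ _ → a))) })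
    , λ { a e zero → embed-injective (trans (sym (single a)) e) }
    where
    single : ∀ (a : Fin 1 → K.Carrier) → combination a (λ _ → 1#) ≈ embed (a zero)
    single a = trans (+-identityʳ _) (*-identityʳ _)

  sum-↑ : ∀ m {n} (f : Fin (m ℕ.+ n) → Carrier) →
    sum f ≈ sum (λ i → f (i ↑ˡ n)) + sum (λ i → f (m ↑ʳ i))
  sum-↑ zero    f = sym (+-identityˡ _)
  sum-↑ (suc m) f = trans (+-congˡ (sum-↑ m (f ∘ suc))) (sym (+-assoc _ _ _))

  sum-combine : ∀ k {m} (f : Fin (k ℕ.* m) → Carrier) →
    sum f ≈ sum {k} (λ i → sum {m} (λ j → f (combine i j)))
  sum-combine zero        f = refl
  sum-combine (suc k) {m} f = trans (sum-↑ m f) (+-congˡ (sum-combine k (λ i → f (m ↑ʳ i))))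

  -- The products e j * θ i are a basis, indexed through `remQuot` and `combine`. Independence is
  -- peeled off in two stages: the coefficients of the θ i vanish in F, then their coordinates
  -- vanish in K.
  HasDegree-* : ∀ {p q m k} {F : Pred Carrier p} {T : Pred Carrier q} →
    IsSubfield F → HasDegree F m →
    (θ : Fin k → Carrier) →
    (∀ i {b} → F b → T (b * θ i)) →
    (∀ {x} → T x → Σ (Fin k → Carrier) λ b → (∀ i → F (b i)) × x ≈ sum (λ i → b i * θ i)) →
    (∀ b → (∀ i → F (b i)) → sum (λ i → b i * θ i) ≈ 0# → ∀ i → b i ≈ 0#) →
    HasDegree T (k ℕ.* m)
  HasDegree-* {m = m} {k} {F} {T} isSubfield (e , e∈ , e-spans , e-independent) θ θ∈ θ-spans θ-independent =
    basis , (λ l → θ∈ _ (e∈ _)) , spans , independent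
    where
    open IsSubfield isSubfield
    basis : Fin (k ℕ.* m) → Carrier
    basis l = e (proj₂ (remQuot {k} m l)) * θ (proj₁ (remQuot {k} m l))

    expand : ∀ a → combination a basis ≈ sum (λ i → combination (λ j → a (combine i j)) e * θ i)
    expand a = trans (sum-combine k _) (sum-cong-≋ λ i → begin
      sum (λ j → embed (a (combine i j)) * basis (combine i j))
        ≈⟨ sum-cong-≋ (λ j → *-congˡ (reflexive (≡.cong (λ l → e (proj₂ l) * θ (proj₁ l)) (Fin.remQuot-combine i j)))) ⟩
      sum (λ j → embed (a (combine i j)) * (e j * θ i))
        ≈⟨ sum-cong-≋ (λ j → *-assoc _ (e j) (θ i)) ⟨
      sum (λ j → embed (a (combine i j)) * e j * θ i)
        ≈⟨ *-distribʳ-sum (θ i) (λ j → embed (a (combine i j)) * e j) ⟨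
      combination (λ j → a (combine i j)) e * θ i ∎)

    spans : ∀ x → T x → ∃ λ a → x ≈ combination a basis
    spans x Tx with θ-spans Tx
    ... | b , b∈ , x≈ = a , trans x≈ (trans (sum-cong-≋ λ i → *-congʳ (begin
      b i                                          ≈⟨ proj₂ (e-spans (b i) (b∈ i)) ⟩
      combination (proj₁ (e-spans (b i) (b∈ i))) e ≈⟨ sum-cong-≋ (λ j → *-congʳ (reflexive (≡.cong (λ l → embed (coordinate l)) (≡.sym (Fin.remQuot-combine i j))))) ⟩
      combination (λ j → a (combine i j)) e        ∎)) (sym (expand a)))
      where
      coordinate : Fin k × Fin m → K.Carrier
      coordinate (i , j) = proj₁ (e-spans (b i) (b∈ i)) j
      a : Fin (k ℕ.* m) → K.Carrier
      a l = coordinate (remQuot m l)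

    independent : ∀ a → combination a basis ≈ 0# → ∀ l → a l K.≈ K.0#
    independent a a≈0 l = K.trans (K.reflexive (≡.cong a (≡.sym (Fin.combine-remQuot {k} m l))))
      (e-independent _ (θ-independent (λ i → combination (λ j → a (combine i j)) e)
        (λ i → sum∈ _ (λ j → mul (base _) (e∈ j))) (trans (sym (expand a)) a≈0) (proj₁ (remQuot m l)))
        (proj₂ (remQuot {k} m l)))

  ⁻¹-unique : ∀ {x y} → ¬ (x ≈ 0#) → x * y ≈ 1# → y ≈ x ⁻¹
  ⁻¹-unique x≉0 xy≈1 = *-cancelˡ x≉0 (trans xy≈1 (sym (*-inverseʳ x≉0)))

  -- With b ≠ 0 the relation would put θ = -a/b into F.
  linear-independent : ∀ {p θ a b} {F : Pred Carrier p} → IsSubfield F → ¬ F θ →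
    F a → F b → a + b * θ ≈ 0# → a ≈ 0# × b ≈ 0#
  linear-independent {θ = θ} {a} {b} isSubfield θ∉ a∈ b∈ e with b ≈? 0#
  ... | yes b≈0 = trans (sym (trans (+-congˡ (trans (*-congʳ b≈0) (zeroˡ θ))) (+-identityʳ a))) e , b≈0
  ... | no  b≉0 = contradiction (resp (sym (/-unique b≉0 (modulo-0 1# e
    (solve 3 (λ a b θ → b :* θ := :- a :+ (a :^ 0) :* (a :+ b :* θ)) refl a b θ))))
    (div b≉0 (neg a∈) b∈)) θ∉
    where open IsSubfield isSubfield

  -- Quadratic extensions

  module Quadratic {p₀} {F : Pred Carrier p₀} (isSubfield : IsSubfield F)
    {θ p q : Carrier} (p∈ : F p) (q∈ : F q) (θ²≈pθ+q : θ * θ ≈ p * θ + q) (θ∉ : ¬ F θ) where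
    open IsSubfield isSubfield

    Span : Pred Carrier (c′ ⊔ ℓ′ ⊔ p₀)
    Span x = ∃₂ λ a b → F a × F b × x ≈ a + b * θ

    independent : ∀ {a b} → F a → F b → a + b * θ ≈ 0# → a ≈ 0# × b ≈ 0#
    independent = linear-independent isSubfield θ∉

    F⊆Span : F ⊆ Span
    F⊆Span {x} x∈ = x , 0# , x∈ , 0∈ , sym (trans (+-congˡ (zeroˡ θ)) (+-identityʳ x))

    θ∈Span : Span θ
    θ∈Span = 0# , 1# , 0∈ , 1∈ , sym (trans (+-identityˡ _) (*-identityˡ θ))

    Span-isSubfield : IsSubfield Span
    Span-isSubfield = record
      { base = λ a → F⊆Span (base a)
      ; add = λ { (a , b , a∈ , b∈ , x≈) (a′ , b′ , a′∈ , b′∈ , y≈) →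
          a + a′ , b + b′ , add a∈ a′∈ , add b∈ b′∈ , trans (+-cong x≈ y≈)
          (solve 5 (λ a b a′ b′ θ → (a :+ b :* θ) :+ (a′ :+ b′ :* θ) := (a :+ a′) :+ (b :+ b′) :* θ)
            refl a b a′ b′ θ) }
      ; neg = λ { (a , b , a∈ , b∈ , x≈) → - a , - b , neg a∈ , neg b∈ , trans (-‿cong x≈)
          (solve 3 (λ a b θ → :- (a :+ b :* θ) := (:- a) :+ (:- b) :* θ) refl a b θ) }
      ; mul = λ { (a , b , a∈ , b∈ , x≈) (a′ , b′ , a′∈ , b′∈ , y≈) →
          a * a′ + b * b′ * q , a * b′ + b * a′ + b * b′ * p ,
          add (mul a∈ a′∈) (mul (mul b∈ b′∈) q∈) ,
          add (add (mul a∈ b′∈) (mul b∈ a′∈)) (mul (mul b∈ b′∈) p∈) ,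
          trans (*-cong x≈ y≈) (modulo (b * b′) θ²≈pθ+q
            (solve 7 (λ a b a′ b′ θ p q → (a :+ b :* θ) :* (a′ :+ b′ :* θ)
              := ((a :* a′ :+ b :* b′ :* q) :+ (a :* b′ :+ b :* a′ :+ b :* b′ :* p) :* θ)
                :+ b :* b′ :* (θ :* θ :- (p :* θ :+ q))) refl a b a′ b′ θ p q)) }
      ; inv = λ { x≉0 (a , b , a∈ , b∈ , x≈) → inverse x≉0 a∈ b∈ x≈ }
      ; resp = λ { x≈y (a , b , a∈ , b∈ , x≈) → a , b , a∈ , b∈ , trans (sym x≈y) x≈ }
      }
      where
      inverse : ∀ {x a b} → ¬ (x ≈ 0#) → F a → F b → x ≈ a + b * θ → Span (x ⁻¹)
      inverse {x} {a} {b} x≉0 a∈ b∈ x≈ =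
        (a + b * p) / N , (- b) / N , div N≉0 conjugate∈ N∈ , div N≉0 (neg b∈) N∈ ,
        sym (⁻¹-unique x≉0 (begin
          x * ((a + b * p) / N + (- b) / N * θ)
            ≈⟨ solve 5 (λ x u v i θ → x :* (u :* i :+ v :* i :* θ) := (x :* (u :+ v :* θ)) :* i)
                 refl x (a + b * p) (- b) (N ⁻¹) θ ⟩
          x * (a + b * p + (- b) * θ) * N ⁻¹   ≈⟨ *-congʳ x*conjugate≈N ⟩
          N * N ⁻¹                             ≈⟨ *-inverseʳ N≉0 ⟩
          1#                                   ∎))
        where
        N : Carrier
        -- The norm of a + bθ: the other root of the quadratic is p - θ, so the conjugate is a + bp
        -- - bθ.
        N = a * a + a * b * p - b * b * q
        conjugate∈ : F (a + b * p)
        conjugate∈ = add a∈ (mul b∈ p∈)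
        N∈ : F N
        N∈ = sub (add (mul a∈ a∈) (mul (mul a∈ b∈) p∈)) (mul (mul b∈ b∈) q∈)
        x*conjugate≈N : x * (a + b * p + (- b) * θ) ≈ N
        x*conjugate≈N = trans (*-congʳ x≈) (modulo (- (b * b)) θ²≈pθ+q
          (solve 5 (λ a b θ p q → (a :+ b :* θ) :* (a :+ b :* p :+ (:- b) :* θ)
            := (a :* a :+ a :* b :* p :- b :* b :* q)
              :+ (:- (b :* b)) :* (θ :* θ :- (p :* θ :+ q))) refl a b θ p q))
        N≉0 : ¬ (N ≈ 0#)
        N≉0 N≈0 = x≉0 (trans x≈ (trans (+-cong a≈0 (trans (*-congʳ b≈0) (zeroˡ θ))) (+-identityˡ 0#)))
          where
          conjugate≈0 : a + b * p ≈ 0# × - b ≈ 0#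
          conjugate≈0 = independent conjugate∈ (neg b∈) (*-cancel-0 x≉0 (trans x*conjugate≈N N≈0))
          b≈0 : b ≈ 0#
          b≈0 = trans (solve 1 (λ b → b := :- :- b) refl b) (trans (-‿cong (proj₂ conjugate≈0)) -0#≈0#)
          a≈0 : a ≈ 0#
          a≈0 = trans (sym (trans (+-congˡ (trans (*-congʳ b≈0) (zeroˡ p))) (+-identityʳ a))) (proj₁ conjugate≈0)

    degree : ∀ {t m} {T : Pred Carrier t} → IsSubfield T → F ⊆ T → T θ → T ⊆ Span →
      HasDegree F m → HasDegree T (2 ℕ.* m)
    degree T-isSubfield F⊆T θ∈T T⊆Span F-degree = HasDegree-* isSubfield F-degree powers
      (λ { zero b∈ → T.mul (F⊆T b∈) T.1∈ ; (suc zero) b∈ → T.mul (F⊆T b∈) θ∈T })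
      (λ x∈ → case T⊆Span x∈ of λ { (a , b , a∈ , b∈ , x≈) →
        (λ { zero → a ; (suc zero) → b }) , (λ { zero → a∈ ; (suc zero) → b∈ }) ,
        trans x≈ (sym (expand a b)) })
      (λ b b∈ e → case independent (b∈ zero) (b∈ (suc zero)) (trans (sym (expand _ _)) e) of λ { (b₀≈0 , b₁≈0) →
        λ { zero → b₀≈0 ; (suc zero) → b₁≈0 } })
      where
      module T = IsSubfield T-isSubfield
      powers : Fin 2 → Carrier
      powers zero       = 1#
      powers (suc zero) = θ
      expand : ∀ a b → a * 1# + (b * θ + 0#) ≈ a + b * θ
      expand a b = +-cong (*-identityʳ a) (+-identityʳ _)

  -- Pure cubic extensions

  module PureCubic {p₀} {F : Pred Carrier p₀} (isSubfield : IsSubfield F)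
    {ω : Carrier} (ω²≈-ω-1 : ω * ω ≈ - 1# * ω + - 1#) (ω∈ : F ω)
    {θ r : Carrier} (r∈ : F r) (θ³≈r : θ ^ 3 ≈ r) (θ∉ : ¬ F θ) where
    open IsSubfield isSubfield
    open CubeRoots ω²≈-ω-1

    Span : Pred Carrier (c′ ⊔ ℓ′ ⊔ p₀)
    Span x = ∃₂ λ a b → ∃ λ c → F a × F b × F c × x ≈ a + b * θ + c * (θ * θ)

    -- The hypotheses give r c³ = b³, and r is not a cube in F.
    no-cube-root : ∀ {a b c} → F b → F c → c * c * r ≈ a * b → a * c ≈ b * b → b ≈ 0# × c ≈ 0#
    no-cube-root {a} {b} {c} b∈ c∈ c²r≈ab ac≈b² with c ≈? 0#
    ... | yes c≈0 = b≈0 , c≈0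
      where
      b≈0 : b ≈ 0#
      b≈0 = [ id , id ]′ (x*y≈0⇒x≈0∨y≈0
        (trans (sym ac≈b²) (trans (*-congˡ c≈0) (zeroʳ a))))
    ... | no c≉0 = contradiction (case x³≈y³⇒x≈ωⁱy [cθ]³≈b³ of λ { (i , cθ≈ωⁱb) →
        resp (sym (/-unique c≉0 cθ≈ωⁱb)) (div c≉0 (mul (pow i ω∈) b∈) c∈) }) θ∉
      where
      [cθ]³≈b³ : (c * θ) ^ 3 ≈ b ^ 3
      [cθ]³≈b³ = modulo (c ^ 3) θ³≈r (trans (modulo c c²r≈ab (trans (modulo b ac≈b²
        (solve 5 (λ a b c θ r → (c :* θ) :^ 3
          := ((b :^ 3 :+ c :^ 3 :* (θ :^ 3 :- r)) :+ c :* (c :* c :* r :- a :* b)) :+ b :* (a :* c :- b :* b))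
          refl a b c θ r)) refl)) refl)

    -- Eliminating θ² between the relation and θ times the relation leaves one of degree 1.
    independent : ∀ {a b c} → F a → F b → F c → a + b * θ + c * (θ * θ) ≈ 0# → a ≈ 0# × b ≈ 0# × c ≈ 0#
    independent {a} {b} {c} a∈ b∈ c∈ e = a≈0 , proj₁ bc≈0 , proj₂ bc≈0
      where
      eliminated : c * c * r - a * b + (a * c - b * b) * θ ≈ 0#
      eliminated = modulo-0 (c * θ - b) e (trans (modulo (- (c * c)) θ³≈r
        (solve 5 (λ a b c θ r → (c :* c :* r :- a :* b) :+ (a :* c :- b :* b) :* θ
          := (con (+ 0) :+ (c :* θ :- b) :* (a :+ b :* θ :+ c :* (θ :* θ)))
            :+ (:- (c :* c)) :* (θ :^ 3 :- r)) refl a b c θ r)) (+-congʳ fromℤ-0))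
      coefficients≈0 : c * c * r - a * b ≈ 0# × a * c - b * b ≈ 0#
      coefficients≈0 = linear-independent isSubfield θ∉ (sub (mul (mul c∈ c∈) r∈) (mul a∈ b∈)) (sub (mul a∈ c∈) (mul b∈ b∈)) eliminated
      bc≈0 : b ≈ 0# × c ≈ 0#
      bc≈0 = no-cube-root b∈ c∈ (x-y≈0⇒x≈y (proj₁ coefficients≈0)) (x-y≈0⇒x≈y (proj₂ coefficients≈0))
      a≈0 : a ≈ 0#
      a≈0 = trans (sym (trans (+-cong (trans (+-congˡ (trans (*-congʳ (proj₁ bc≈0)) (zeroˡ θ))) (+-identityʳ a))
        (trans (*-congʳ (proj₂ bc≈0)) (zeroˡ _))) (+-identityʳ a))) e

    F⊆Span : F ⊆ Span
    F⊆Span {x} x∈ = x , 0# , 0# , x∈ , 0∈ , 0∈ ,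
      sym (trans (+-cong (trans (+-congˡ (zeroˡ θ)) (+-identityʳ x)) (zeroˡ _)) (+-identityʳ x))

    θ∈Span : Span θ
    θ∈Span = 0# , 1# , 0# , 0∈ , 1∈ , 0∈ ,
      sym (trans (+-cong (trans (+-identityˡ _) (*-identityˡ θ)) (zeroˡ _)) (+-identityʳ θ))

    Span-isSubfield : IsSubfield Span
    Span-isSubfield = record
      { base = λ a → F⊆Span (base a)
      ; add = λ { (a , b , c , a∈ , b∈ , c∈ , x≈) (a′ , b′ , c′ , a′∈ , b′∈ , c′∈ , y≈) →
          a + a′ , b + b′ , c + c′ , add a∈ a′∈ , add b∈ b′∈ , add c∈ c′∈ , trans (+-cong x≈ y≈)
          (solve 7 (λ a b c a′ b′ c′ θ → (a :+ b :* θ :+ c :* (θ :* θ)) :+ (a′ :+ b′ :* θ :+ c′ :* (θ :* θ))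
            := (a :+ a′) :+ (b :+ b′) :* θ :+ (c :+ c′) :* (θ :* θ))
            refl a b c a′ b′ c′ θ) }
      ; neg = λ { (a , b , c , a∈ , b∈ , c∈ , x≈) →
          - a , - b , - c , neg a∈ , neg b∈ , neg c∈ , trans (-‿cong x≈)
          (solve 4 (λ a b c θ → :- (a :+ b :* θ :+ c :* (θ :* θ))
            := (:- a) :+ (:- b) :* θ :+ (:- c) :* (θ :* θ)) refl a b c θ) }
      ; mul = λ { (a , b , c , a∈ , b∈ , c∈ , x≈) (a′ , b′ , c′ , a′∈ , b′∈ , c′∈ , y≈) →
          a * a′ + (b * c′ + c * b′) * r , a * b′ + b * a′ + c * c′ * r , a * c′ + b * b′ + c * a′ ,
          add (mul a∈ a′∈) (mul (add (mul b∈ c′∈) (mul c∈ b′∈)) r∈) ,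
          add (add (mul a∈ b′∈) (mul b∈ a′∈)) (mul (mul c∈ c′∈) r∈) ,
          add (add (mul a∈ c′∈) (mul b∈ b′∈)) (mul c∈ a′∈) ,
          trans (*-cong x≈ y≈) (modulo (b * c′ + c * b′ + c * c′ * θ) θ³≈r
            (solve 8 (λ a b c a′ b′ c′ θ r →
              (a :+ b :* θ :+ c :* (θ :* θ)) :* (a′ :+ b′ :* θ :+ c′ :* (θ :* θ))
              := ((a :* a′ :+ (b :* c′ :+ c :* b′) :* r) :+ (a :* b′ :+ b :* a′ :+ c :* c′ :* r) :* θ
                  :+ (a :* c′ :+ b :* b′ :+ c :* a′) :* (θ :* θ))
                :+ (b :* c′ :+ c :* b′ :+ c :* c′ :* θ) :* (θ :^ 3 :- r)) refl a b c a′ b′ c′ θ r)) }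
      ; inv = λ { x≉0 (a , b , c , a∈ , b∈ , c∈ , x≈) → inverse x≉0 a∈ b∈ c∈ x≈ }
      ; resp = λ { x≈y (a , b , c , a∈ , b∈ , c∈ , x≈) →
          a , b , c , a∈ , b∈ , c∈ , trans (sym x≈y) x≈ }
      }
      where
      inverse : ∀ {x a b c} → ¬ (x ≈ 0#) → F a → F b → F c → x ≈ a + b * θ + c * (θ * θ) → Span (x ⁻¹)
      inverse {x} {a} {b} {c} x≉0 a∈ b∈ c∈ x≈ =
        u / N , v / N , w / N , div N≉0 u∈ N∈ , div N≉0 v∈ N∈ , div N≉0 w∈ N∈ ,
        sym (⁻¹-unique x≉0 (begin
          x * (u / N + v / N * θ + w / N * (θ * θ))
            ≈⟨ solve 6 (λ x u v w i θ → x :* (u :* i :+ v :* i :* θ :+ w :* i :* (θ :* θ))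
                 := (x :* (u :+ v :* θ :+ w :* (θ :* θ))) :* i)
                 refl x u v w (N ⁻¹) θ ⟩
          x * (u + v * θ + w * (θ * θ)) * N ⁻¹   ≈⟨ *-congʳ x*adjoint≈N ⟩
          N * N ⁻¹                               ≈⟨ *-inverseʳ N≉0 ⟩
          1#                                     ∎))
        where
        u v w N : Carrier
        -- u + vθ + wθ² is (a + bωθ + cω²θ²)(a + bω²θ + cωθ²), the product of the other two
        -- conjugates of x, and N is the norm a³ + b³r + c³r² - 3abcr.
        u = a * a - b * c * r
        v = c * c * r - a * b
        w = b * b - a * c
        N = a * u + b * w * r + c * v * r
        u∈ : F u
        u∈ = sub (mul a∈ a∈) (mul (mul b∈ c∈) r∈)
        v∈ : F v
        v∈ = sub (mul (mul c∈ c∈) r∈) (mul a∈ b∈)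
        w∈ : F w
        w∈ = sub (mul b∈ b∈) (mul a∈ c∈)
        N∈ : F N
        N∈ = add (add (mul a∈ u∈) (mul (mul b∈ w∈) r∈)) (mul (mul c∈ v∈) r∈)
        x*adjoint≈N : x * (u + v * θ + w * (θ * θ)) ≈ N
        x*adjoint≈N = trans (*-congʳ x≈) (modulo (b * w + c * v + c * w * θ) θ³≈r
          (solve 5 (λ a b c θ r →
            let u = a :* a :- b :* c :* r ; v = c :* c :* r :- a :* b ; w = b :* b :- a :* c in
            (a :+ b :* θ :+ c :* (θ :* θ)) :* (u :+ v :* θ :+ w :* (θ :* θ))
            := (a :* u :+ b :* w :* r :+ c :* v :* r)
              :+ (b :* w :+ c :* v :+ c :* w :* θ) :* (θ :^ 3 :- r)) refl a b c θ r))
        N≉0 : ¬ (N ≈ 0#)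
        N≉0 N≈0 = x≉0 (trans x≈ (trans (+-cong (+-cong a≈0 (trans (*-congʳ (proj₁ bc≈0)) (zeroˡ θ)))
            (trans (*-congʳ (proj₂ bc≈0)) (zeroˡ _))) (trans (+-congʳ (+-identityˡ 0#)) (+-identityˡ 0#))))
          where
          adjoint≈0 : u ≈ 0# × v ≈ 0# × w ≈ 0#
          adjoint≈0 = independent u∈ v∈ w∈ (*-cancel-0 x≉0 (trans x*adjoint≈N N≈0))
          bc≈0 : b ≈ 0# × c ≈ 0#
          bc≈0 = no-cube-root b∈ c∈ (x-y≈0⇒x≈y (proj₁ (proj₂ adjoint≈0)))
            (sym (x-y≈0⇒x≈y (proj₂ (proj₂ adjoint≈0))))
          a≈0 : a ≈ 0#
          a≈0 = [ id , id ]′ (x*y≈0⇒x≈0∨y≈0 (trans (x-y≈0⇒x≈y (proj₁ adjoint≈0))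
            (trans (*-congʳ (trans (*-congʳ (proj₁ bc≈0)) (zeroˡ c))) (zeroˡ r))))

    degree : ∀ {t m} {T : Pred Carrier t} → IsSubfield T → F ⊆ T → T θ → T ⊆ Span →
      HasDegree F m → HasDegree T (3 ℕ.* m)
    degree T-isSubfield F⊆T θ∈T T⊆Span F-degree = HasDegree-* isSubfield F-degree powers
      (λ { zero b∈ → T.mul (F⊆T b∈) T.1∈
         ; (suc zero) b∈ → T.mul (F⊆T b∈) θ∈T
         ; (suc (suc zero)) b∈ → T.mul (F⊆T b∈) (T.mul θ∈T θ∈T) })
      (λ x∈ → case T⊆Span x∈ of λ { (a , b , c , a∈ , b∈ , c∈ , x≈) →
        (λ { zero → a ; (suc zero) → b ; (suc (suc zero)) → c }) ,
        (λ { zero → a∈ ; (suc zero) → b∈ ; (suc (suc zero)) → c∈ }) ,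
        trans x≈ (sym (expand a b c)) })
      (λ b b∈ e → case independent (b∈ zero) (b∈ (suc zero)) (b∈ (suc (suc zero))) (trans (sym (expand _ _ _)) e) of
        λ { (b₀≈0 , b₁≈0 , b₂≈0) → λ { zero → b₀≈0 ; (suc zero) → b₁≈0 ; (suc (suc zero)) → b₂≈0 } })
      where
      module T = IsSubfield T-isSubfield
      powers : Fin 3 → Carrier
      powers zero             = 1#
      powers (suc zero)       = θ
      powers (suc (suc zero)) = θ * θ
      expand : ∀ a b c → a * 1# + (b * θ + (c * (θ * θ) + 0#)) ≈ a + b * θ + c * (θ * θ)
      expand a b c = trans (+-cong (*-identityʳ a) (+-congˡ (+-identityʳ _))) (sym (+-assoc _ _ _))

    -- Comparing coefficients in (a + bθ + cθ²)² = y² gives c²r + 2ab = 0 and b² + 2ac = 0. These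
    -- are the hypotheses of `no-cube-root` with -2a in place of a, so b = c = 0 and y = a.
    square-root∈ : ∀ {y} → F (y ^ 2) → Span y → F y
    square-root∈ {y} y²∈ (a , b , c , a∈ , b∈ , c∈ , y≈) = resp (sym (trans y≈
        (trans (+-cong (trans (+-congˡ (trans (*-congʳ (proj₁ bc≈0)) (zeroˡ θ))) (+-identityʳ a))
          (trans (*-congʳ (proj₂ bc≈0)) (zeroˡ _))) (+-identityʳ a)))) a∈
      where
      u v w : Carrier
      u = a * a + fromℤ (+ 2) * b * c * r - y ^ 2
      v = c * c * r + fromℤ (+ 2) * a * b
      w = b * b + fromℤ (+ 2) * a * c
      relation : u + v * θ + w * (θ * θ) ≈ 0#
      relation = modulo (- (a + b * θ + c * (θ * θ)) - y) y≈ (trans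
        (modulo (- (fromℤ (+ 2) * b * c + c * c * θ)) θ³≈r
          (solve 6 (λ a b c θ r y →
            (a :* a :+ con (+ 2) :* b :* c :* r :- y :^ 2) :+ (c :* c :* r :+ con (+ 2) :* a :* b) :* θ
              :+ (b :* b :+ con (+ 2) :* a :* c) :* (θ :* θ)
            := (con (+ 0) :+ (:- (a :+ b :* θ :+ c :* (θ :* θ)) :- y) :* (y :- (a :+ b :* θ :+ c :* (θ :* θ))))
              :+ (:- (con (+ 2) :* b :* c :+ c :* c :* θ)) :* (θ :^ 3 :- r)) refl a b c θ r y))
        (+-congʳ fromℤ-0))
      uvw≈0 : u ≈ 0# × v ≈ 0# × w ≈ 0#
      uvw≈0 = independent
        (sub (add (mul a∈ a∈) (mul (mul (mul (natural 2) b∈) c∈) r∈)) y²∈)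
        (add (mul (mul c∈ c∈) r∈) (mul (mul (natural 2) a∈) b∈))
        (add (mul b∈ b∈) (mul (mul (natural 2) a∈) c∈)) relation
      bc≈0 : b ≈ 0# × c ≈ 0#
      bc≈0 = no-cube-root {a = - (fromℤ (+ 2) * a)} b∈ c∈
        (modulo-0 1# (proj₁ (proj₂ uvw≈0)) (solve 4 (λ a b c r → c :* c :* r
          := (:- (con (+ 2) :* a)) :* b :+ (a :^ 0) :* (c :* c :* r :+ con (+ 2) :* a :* b)) refl a b c r))
        (modulo-0 (- 1#) (proj₂ (proj₂ uvw≈0)) (solve 3 (λ a b c → (:- (con (+ 2) :* a)) :* c
          := b :* b :+ (:- (a :^ 0)) :* (b :* b :+ con (+ 2) :* a :* c)) refl a b c))

  -- Adjoining one element to a finitely generated field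

  weaken : ∀ {θ xs} → K⟨ xs ⟩ ⊆ K⟨ θ ∷ xs ⟩
  weaken = K⟮⟯-least K⟮⟯-isSubfield (λ x∈ → ⟮gen⟯ (there x∈))

  head∈ : ∀ {θ xs} → K⟨ θ ∷ xs ⟩ θ
  head∈ = ⟮gen⟯ (here refl)

  adjoin-least : ∀ {p θ xs} {F : Pred Carrier p} → IsSubfield F → K⟨ xs ⟩ ⊆ F → F θ → K⟨ θ ∷ xs ⟩ ⊆ F
  adjoin-least isSubfield xs⊆F Fθ = K⟮⟯-least isSubfield
    λ { (here x≈θ) → IsSubfield.resp isSubfield (sym x≈θ) Fθ ; (there x∈) → xs⊆F (⟮gen⟯ x∈) }

  -- `1 ℕ.* m` is what `2 ℕ.^ 0 ℕ.* m` and `3 ℕ.^ 0 ℕ.* m` reduce to, so this serves the quadratic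
  -- and the cubic step alike.
  adjoin-member : ∀ {θ xs m} → K⟨ xs ⟩ θ → HasDegree K⟨ xs ⟩ m → HasDegree K⟨ θ ∷ xs ⟩ (1 ℕ.* m)
  adjoin-member {m = m} θ∈ h = ≡.subst (HasDegree _) (≡.sym (ℕ.*-identityˡ m))
    (HasDegree-resp weaken (adjoin-least K⟮⟯-isSubfield id θ∈) h)

  quadratic-degree : ∀ {xs θ p q m} → K⟨ xs ⟩ p → K⟨ xs ⟩ q → θ * θ ≈ p * θ + q →
    (θ∈? : Dec (K⟨ xs ⟩ θ)) → HasDegree K⟨ xs ⟩ m → HasDegree K⟨ θ ∷ xs ⟩ (2 ℕ.^ falses θ∈? ℕ.* m)
  quadratic-degree p∈ q∈ θ²≈ (yes θ∈) h = adjoin-member θ∈ h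
  quadratic-degree p∈ q∈ θ²≈ (no θ∉)  h = degree K⟮⟯-isSubfield weaken head∈
    (adjoin-least Span-isSubfield F⊆Span θ∈Span) h
    where open Quadratic K⟮⟯-isSubfield p∈ q∈ θ²≈ θ∉

  cubic-degree : ∀ {ω xs θ r m} → ω * ω ≈ - 1# * ω + - 1# → K⟨ xs ⟩ ω → K⟨ xs ⟩ r → θ ^ 3 ≈ r →
    (θ∈? : Dec (K⟨ xs ⟩ θ)) → HasDegree K⟨ xs ⟩ m → HasDegree K⟨ θ ∷ xs ⟩ (3 ℕ.^ falses θ∈? ℕ.* m)
  cubic-degree ω² ω∈ r∈ θ³≈r (yes θ∈) h = adjoin-member θ∈ h
  cubic-degree ω² ω∈ r∈ θ³≈r (no θ∉)  h = degree K⟮⟯-isSubfield weaken head∈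
    (adjoin-least Span-isSubfield F⊆Span θ∈Span) h
    where open PureCubic K⟮⟯-isSubfield ω² ω∈ r∈ θ³≈r θ∉

  square-root-descends : ∀ {ω xs θ y} → ω * ω ≈ - 1# * ω + - 1# → K⟨ xs ⟩ ω → K⟨ xs ⟩ (θ ^ 3) →
    K⟨ xs ⟩ (y ^ 2) → Dec (K⟨ xs ⟩ θ) → K⟨ θ ∷ xs ⟩ y → K⟨ xs ⟩ y
  square-root-descends ω² ω∈ θ³∈ y²∈ (yes θ∈) y∈ = adjoin-least K⟮⟯-isSubfield id θ∈ y∈
  square-root-descends ω² ω∈ θ³∈ y²∈ (no θ∉)  y∈ =
    square-root∈ y²∈ (adjoin-least Span-isSubfield F⊆Span θ∈Span y∈)
    where open PureCubic K⟮⟯-isSubfield ω² ω∈ θ³∈ refl θ∉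

  K⟨[]⟩⊆InK : K⟨ [] ⟩ ⊆ InK
  K⟨[]⟩⊆InK = K⟮⟯-least InK-isSubfield λ ()

  InK⊆K⟨[]⟩ : InK ⊆ K⟨ [] ⟩
  InK⊆K⟨[]⟩ (image a x≈a) = ⟮resp⟯ (sym x≈a) (⟮base⟯ a)

-- The roots of the 5-division polynomial and the tower below K₅

-- Coordinates with respect to 1, ω, η, ωη, ζ, ωζ, ηζ, ωηζ.
⟨_,_,_,_,_,_,_,_⟩ : (a b c d e f g h : ℤ) → A.Carrier
⟨ a , b , c , d , e , f , g , h ⟩ = ((a +θ b) +θ (c +θ d)) +θ ((e +θ f) +θ (g +θ h))

⟨_∣_⟩ : (a b : ℤ) → A.Carrier
⟨ a ∣ b ⟩ = ⟨ a , b , + 0 , + 0 , + 0 , + 0 , + 0 , + 0 ⟩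

-- Opaque, because type checking is slow when their images in a field are unfolded.
opaque
  -- Five times the conjugates over ℚ(ζ₃) of δ₁, which are the roots of ψ₅(X , 1).
  d : Fin 4 → A.Carrier
  d zero                   = ⟨ -[1+ 7 ] , + 84 , + 24 , -[1+ 131 ] , + 48 , + 96 , -[1+ 83 ] , -[1+ 167 ] ⟩
  d (suc zero)             = ⟨ -[1+ 91 ] , -[1+ 83 ] , + 156 , + 132 , -[1+ 47 ] , -[1+ 95 ] , + 84 , + 168 ⟩
  d (suc (suc zero))       = ⟨ -[1+ 115 ] , + 48 , -[1+ 71 ] , + 36 , -[1+ 83 ] , -[1+ 167 ] , -[1+ 47 ] , -[1+ 95 ] ⟩
  d (suc (suc (suc zero))) = ⟨ -[1+ 163 ] , -[1+ 47 ] , -[1+ 107 ] , -[1+ 35 ] , + 84 , + 168 , + 48 , + 96 ⟩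

  -- For a 5-torsion point P = (x , y) with x³ = δ₁ c, the points (r i x , s i y)
  -- are P, 2P, √-3 P and 2√-3 P, where √-3 is an endomorphism of the curve.
  r s : Fin 4 → A.Carrier
  r zero                   = A.1#
  r (suc zero)             = ⟨ + 0 , + 1 , -[1+ 1 ] , -[1+ 0 ] , + 0 , + 0 , -[1+ 0 ] , -[1+ 1 ] ⟩
  r (suc (suc zero))       = ⟨ + 2 , -[1+ 0 ] , + 1 , -[1+ 0 ] , + 2 , + 4 , + 1 , + 2 ⟩
  r (suc (suc (suc zero))) = ⟨ -[1+ 0 ] , -[1+ 0 ] , + 0 , + 0 , + 1 , + 2 , + 1 , + 2 ⟩
  s zero                   = A.1#
  s (suc zero)             = ⟨ -[1+ 2 ] , -[1+ 1 ] , + 4 , + 4 , -[1+ 1 ] , -[1+ 3 ] , + 2 , + 4 ⟩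
  s (suc (suc zero))       = ⟨ -[1+ 2 ] , -[1+ 3 ] , -[1+ 1 ] , -[1+ 1 ] , + 4 , + 0 , + 2 , + 0 ⟩
  s (suc (suc (suc zero))) = ⟨ -[1+ 0 ] , -[1+ 1 ] , + 0 , -[1+ 1 ] , -[1+ 1 ] , + 0 , + 0 , + 0 ⟩

  -- This and the next family let the equations x³ = δ₁c and y² = (δ₁ + 1)c pass to the points (r i
  -- x , s i y) and the other roots. Each instance is a closed equation between octuples of
  -- integers.
  d₀r³≡d : ∀ i → d zero A.* (r i A.* (r i A.* r i)) ≡ d i
  d₀r³≡d zero                   = toWitness {a? = _ ≟ζ _} _
  d₀r³≡d (suc zero)             = toWitness {a? = _ ≟ζ _} _
  d₀r³≡d (suc (suc zero))       = toWitness {a? = _ ≟ζ _} _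
  d₀r³≡d (suc (suc (suc zero))) = toWitness {a? = _ ≟ζ _} _

  [d₀+5]s²≡d+5 : ∀ i → (d zero A.+ ⟨ + 5 ∣ + 0 ⟩) A.* (s i A.* s i) ≡ d i A.+ ⟨ + 5 ∣ + 0 ⟩
  [d₀+5]s²≡d+5 zero                   = toWitness {a? = _ ≟ζ _} _
  [d₀+5]s²≡d+5 (suc zero)             = toWitness {a? = _ ≟ζ _} _
  [d₀+5]s²≡d+5 (suc (suc zero))       = toWitness {a? = _ ≟ζ _} _
  [d₀+5]s²≡d+5 (suc (suc (suc zero))) = toWitness {a? = _ ≟ζ _} _

-- Counting the conditions that hold

cons-decided : ∀ {a n} {P : Set a} {Ps} (P? : Dec P) →
  ExactlyFalse n Ps → ExactlyFalse (falses P? ℕ.+ n) (P ∷ Ps)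
cons-decided (yes p) = true∷ p
cons-decided (no ¬p) = false∷ ¬p

-- The count remembers which propositions fail, so it yields the decisions from which the tower is
-- built.
uncons-decided : ∀ {a n} {P : Set a} {Ps} → ExactlyFalse n (P ∷ Ps) →
  Σ (Dec P) λ P? → ∃ λ m → ExactlyFalse m Ps × n ≡ falses P? ℕ.+ m
uncons-decided (false∷ ¬p ps) = no ¬p , _ , ps , ≡.refl
uncons-decided (true∷ p ps)   = yes p , _ , ps , ≡.refl

ExactlyFalse-≤-length : ∀ {a n} {Ps : List (Set a)} → ExactlyFalse n Ps → n ≤ length Ps
ExactlyFalse-≤-length []            = z≤n
ExactlyFalse-≤-length (false∷ _ ps) = s≤s (ExactlyFalse-≤-length ps)
ExactlyFalse-≤-length (true∷ _ ps)  = ℕ.m≤n⇒m≤1+n (ExactlyFalse-≤-length ps)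

-- Quadratic relations for primitive third and fifth roots of unity

module CyclotomicRelations {c ℓ} (F : DiscreteField c ℓ) where
  open DiscreteField F hiding (zero)
  open FieldProperties F
  open ℤ-Solver
  open import Relation.Binary.Reasoning.Setoid setoid

  private
    1^-≈1 : ∀ {z} → z ≈ 1# → z ^ 1 ≈ 1#
    1^-≈1 = trans (*-identityʳ _)

  -- ω³ - 1 = (ω - 1)(ω² + ω + 1), and primitivity excludes ω = 1.
  ω²≈-ω-1 : ∀ {ω} → PrimitiveRoot 3 ω → ω * ω ≈ - 1# * ω + - 1#
  ω²≈-ω-1 {ω} (ω³≈1 , minimal) = x-y≈0⇒x≈y (*-cancel-0 {ω - 1#}
    (λ e → minimal 1 (s≤s z≤n) (s≤s (s≤s z≤n)) (1^-≈1 (x-y≈0⇒x≈y e)))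
    (trans (solve 1 (λ ω → (ω :- ω :^ 0) :* (ω :* ω :- ((:- ω :^ 0) :* ω :+ (:- ω :^ 0))) := ω :^ 3 :- ω :^ 0)
      refl ω) (x≈y⇒x∙y⁻¹≈ε ω³≈1)))

  module _ {ζ} (ζ-primitive : PrimitiveRoot 5 ζ) where

    ζ≉0 : ¬ (ζ ≈ 0#)
    ζ≉0 ζ≈0 = 1≉0 (trans (sym (proj₁ ζ-primitive)) (trans (*-congʳ ζ≈0) (zeroˡ _)))

    ζ²≈ηζ-1 : ζ * ζ ≈ (ζ + ζ ⁻¹) * ζ + - 1#
    ζ²≈ηζ-1 = modulo (- 1#) (*-inverseʳ ζ≉0) (solve 2 (λ ζ i →
      ζ :* ζ := ((ζ :+ i) :* ζ :+ (:- ζ :^ 0)) :+ (:- ζ :^ 0) :* (ζ :* i :- ζ :^ 0)) refl ζ (ζ ⁻¹))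

    private
      Φ₅≈0 : ζ ^ 4 + ζ ^ 3 + ζ ^ 2 + ζ + 1# ≈ 0#
      Φ₅≈0 = *-cancel-0 {ζ - 1#}
        (λ e → proj₂ ζ-primitive 1 (s≤s z≤n) (s≤s (s≤s z≤n)) (1^-≈1 (x-y≈0⇒x≈y e)))
        (trans (solve 1 (λ ζ → (ζ :- ζ :^ 0) :* (ζ :^ 4 :+ ζ :^ 3 :+ ζ :^ 2 :+ ζ :+ ζ :^ 0) := ζ :^ 5 :- ζ :^ 0)
          refl ζ) (x≈y⇒x∙y⁻¹≈ε (proj₁ ζ-primitive)))

    -- Dividing Φ₅(ζ) = 0 by ζ² gives η² + η - 1 = 0. The solver treats ζ⁻¹ as a second variable i,
    -- so a multiple of ζi - 1 has to be supplied too.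
    η²≈1-η : (ζ + ζ ⁻¹) * (ζ + ζ ⁻¹) ≈ - 1# * (ζ + ζ ⁻¹) + 1#
    η²≈1-η = modulo-0 (ζ ⁻¹ ^ 2) Φ₅≈0 (trans
      (modulo (- (ζ ^ 2 + ζ) * (1# + ζ * ζ ⁻¹) - (ζ * ζ ⁻¹ - 1#) - ζ ⁻¹) (*-inverseʳ ζ≉0)
      (solve 2 (λ ζ i → (ζ :+ i) :* (ζ :+ i)
        := (((:- ζ :^ 0) :* (ζ :+ i) :+ ζ :^ 0) :+ i :^ 2 :* (ζ :^ 4 :+ ζ :^ 3 :+ ζ :^ 2 :+ ζ :+ ζ :^ 0))
          :+ ((:- (ζ :^ 2 :+ ζ)) :* (ζ :^ 0 :+ ζ :* i) :- (ζ :* i :- ζ :^ 0) :- i) :* (ζ :* i :- ζ :^ 0))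
        refl ζ (ζ ⁻¹))) refl)

-- The generators of the 5-division field and its degree

module DivisionFieldDegree {c ℓ c′ ℓ′} (K : NumberField c ℓ)
       (K̄ : AlgebraicClosure (NumberField.discreteField K) c′ ℓ′)
       (c₀ : NumberField.Carrier K) (c₀≉0 : ¬ (NumberField._≈_ K c₀ (NumberField.0# K)))
       (ω ζ : AlgebraicClosure.Carrier K̄)
       (ω-primitive : AlgebraicClosure.PrimitiveRoot K̄ 3 ω)
       (ζ-primitive : AlgebraicClosure.PrimitiveRoot K̄ 5 ζ)
       where
  private module K = NumberField K
  open AlgebraicClosure K̄ hiding (zero)
  open Setting K K̄ renaming
    (base to ⟮base⟯; gen to ⟮gen⟯; add to ⟮add⟯; neg to ⟮neg⟯; mul to ⟮mul⟯; inv to ⟮inv⟯; resp to ⟮resp⟯)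
  open Membership setoid using (_∈_)
  open FieldProperties discreteField
  open ClosureProperties K K̄
  open FiveTorsion K K̄
  open Subfields K K̄
  open CyclotomicRelations discreteField
  open import Relation.Binary.Reasoning.Setoid setoid

  private
    ω² = ω²≈-ω-1 ω-primitive
    C = embed c₀
    η = ζ + ζ ⁻¹

  open CyclotomicCoefficients commutativeRing
  open Cyclotomic ω η ζ ω² (η²≈1-η ζ-primitive) (ζ²≈ηζ-1 ζ-primitive)
  open CubeRoots ω²
  open _-Raw-AlmostCommutative⟶_ ζ-morphism using (⟦_⟧) renaming (+-homo to ⟦⟧-+)

  ⟦⟨a∣b⟩⟧ : ∀ a b → ⟦ ⟨ a ∣ b ⟩ ⟧ ≈ fromℤ a + fromℤ b * ω
  ⟦⟨a∣b⟩⟧ a b = solve 5 (λ a b ω η ζ → ((a :+ b :* ω) :+ (o :+ o :* ω) :* η)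
      :+ ((o :+ o :* ω) :+ (o :+ o :* ω) :* η) :* ζ := a :+ b :* ω)
    refl (fromℤ a) (fromℤ b) ω η ζ
    where
    open ℤ-Solver
    o : ∀ {n} → Polynomial n
    o = con (+ 0)

  ⟦⟨a∣0⟩⟧ : ∀ a → ⟦ ⟨ a ∣ + 0 ⟩ ⟧ ≈ fromℤ a
  ⟦⟨a∣0⟩⟧ a = trans (⟦⟨a∣b⟩⟧ a (+ 0)) (trans (+-congˡ (trans (*-congʳ fromℤ-0) (zeroˡ ω))) (+-identityʳ _))

  opaque
    unfolding d

    -- Ties the table `d` to δ₁: powers of ζ are reduced by ζ² = ηζ - 1 and ζ³ = -ηζ - η.
    5δ₁≈d₀ : fromℤ (+ 5) * δ₁ ω ζ ≈ ⟦ d zero ⟧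
    5δ₁≈d₀ = begin
      fromℤ (+ 5) * - (E / (5 · 1#))   ≈⟨ solve 3 (λ a b c → a :* :- (b :* c) := :- (b :* (a :* c))) refl _ E _ ⟩
      - (E * (fromℤ (+ 5) * (5 · 1#) ⁻¹)) ≈⟨ -‿cong (*-congˡ (trans (*-congʳ (sym 5·1≈5)) (*-inverseʳ 5·1≉0))) ⟩
      - (E * 1#)                       ≈⟨ -‿cong (*-identityʳ E) ⟩
      - E                              ≈⟨ -‿cong (+-cong (+-cong (+-cong (+-cong
          (*-cong (+-cong (-‿cong (fromℤ-· 132 ω)) (fromℤ-· 24 1#)) ζ³≈)
          (*-cong (+-cong (fromℤ-· 36 ω) (fromℤ-· 108 1#)) ζ²≈))
          (*-congʳ (+-cong (-‿cong (fromℤ-· 96 ω)) (-‿cong (fromℤ-· 48 1#)))))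
          (-‿cong (fromℤ-· 48 ω))) (fromℤ-· 116 1#)) ⟩
      _ ≈⟨ solve 3 (λ ω η ζ → :-
          ( (:- (con (+ 132) :* ω) :+ con (+ 24) :* ω :^ 0) :* (:- η :* ζ :- η)
          :+ (con (+ 36) :* ω :+ con (+ 108) :* ω :^ 0) :* (η :* ζ :- ω :^ 0)
          :+ (:- (con (+ 96) :* ω) :- con (+ 48) :* ω :^ 0) :* ζ
          :- con (+ 48) :* ω :+ con (+ 116) :* ω :^ 0)
          := ((con -[1+ 7 ] :+ con (+ 84) :* ω) :+ (con (+ 24) :+ con -[1+ 131 ] :* ω) :* η)
            :+ ((con (+ 48) :+ con (+ 96) :* ω) :+ (con -[1+ 83 ] :+ con -[1+ 167 ] :* ω) :* η) :* ζ)
          refl ω η ζ ⟩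
      ⟦ d zero ⟧ ∎
      where
      open ℤ-Solver hiding (⟦_⟧)
      E : Carrier
      E = (- (132 · ω) + 24 · 1#) * ζ ^ 3 + (36 · ω + 108 · 1#) * ζ ^ 2
        + (- (96 · ω) - 48 · 1#) * ζ - 48 · ω + 116 · 1#
      5·1≈5 : 5 · 1# ≈ fromℤ (+ 5)
      5·1≈5 = trans (fromℤ-· 5 1#) (*-identityʳ _)
      5·1≉0 : ¬ (5 · 1# ≈ 0#)
      5·1≉0 e = fromℤ-≉0 4 (trans (sym 5·1≈5) e)
      ζ²≈ : ζ ^ 2 ≈ η * ζ - 1#
      ζ²≈ = trans (*-congˡ (*-identityʳ ζ)) (ζ²≈ηζ-1 ζ-primitive)
      ζ³≈ : ζ ^ 3 ≈ - η * ζ - η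
      ζ³≈ = modulo (ζ + η) (ζ²≈ηζ-1 ζ-primitive) (trans (modulo ζ (η²≈1-η ζ-primitive)
        (solve 2 (λ η ζ → ζ :^ 3 := ((:- η :* ζ :- η) :+ (ζ :+ η) :* (ζ :* ζ :- (η :* ζ :+ (:- ζ :^ 0))))
          :+ ζ :* (η :* η :- ((:- ζ :^ 0) :* η :+ ζ :^ 0))) refl η ζ)) refl)

  opaque
    unfolding d

    -- The product has leading coefficient 5⁴ and `ψ₅` has 5, hence the factor 125. The integer
    -- constants are first rewritten as images from ℤ[ω,η,ζ], where both sides are expanded in X and
    -- C.
    ψ₅-factors : ∀ X → fromℤ (+ 125) * ψ₅ X C ≈
      (fromℤ (+ 5) * X - ⟦ d zero ⟧ * C) * ((fromℤ (+ 5) * X - ⟦ d (suc zero) ⟧ * C)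
      * ((fromℤ (+ 5) * X - ⟦ d (suc (suc zero)) ⟧ * C) * (fromℤ (+ 5) * X - ⟦ d (suc (suc (suc zero))) ⟧ * C)))
    ψ₅-factors X = begin
      _ ≈⟨ *-cong (int 125) (+-cong (+-cong (+-cong (+-cong (*-congʳ (int 5)) (*-congʳ (*-congʳ (int 380))))
             (-‿cong (*-congʳ (*-congʳ (int 240))))) (-‿cong (*-congʳ (*-congʳ (int 1600))))) (-‿cong (*-congʳ (int 256)))) ⟩
      _ ≈⟨ ζ-identity (n 125 :* (n 5 :* u :^ 4 :+ n 380 :* u :^ 3 :* v :- n 240 :* u :^ 2 :* v :^ 2
             :- n 1600 :* u :* v :^ 3 :- n 256 :* v :^ 4))
             ((n 5 :* u :- con (d zero) :* v) :* ((n 5 :* u :- con (d (suc zero)) :* v)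
             :* ((n 5 :* u :- con (d (suc (suc zero))) :* v) :* (n 5 :* u :- con (d (suc (suc (suc zero)))) :* v))))
             _ (X ∷ C ∷ []) ⟩
      _ ≈⟨ *-cong factor (*-cong factor (*-cong factor factor)) ⟨
      _ ∎
      where
      open ζ-Solver hiding (⟦_⟧)
      n : ∀ {m} → ℕ → Polynomial m
      n k = con ⟨ + k ∣ + 0 ⟩
      u v : Polynomial 2
      u = var zero
      v = var (suc zero)
      int : ∀ k → fromℤ (+ k) ≈ ⟦ ⟨ + k ∣ + 0 ⟩ ⟧
      int k = sym (⟦⟨a∣0⟩⟧ (+ k))
      factor : ∀ {z} → fromℤ (+ 5) * X - z ≈ ⟦ ⟨ + 5 ∣ + 0 ⟩ ⟧ * X - z
      factor = +-congʳ (*-congʳ (int 5))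

  factor : Carrier → Fin 4 → Carrier
  factor X i = fromℤ (+ 5) * X - ⟦ d i ⟧ * C

  factors : Carrier → Carrier
  factors X = factor X zero * (factor X (suc zero) * (factor X (suc (suc zero)) * factor X (suc (suc (suc zero)))))

  factor≈0⇒factors≈0 : ∀ {X} i → factor X i ≈ 0# → factors X ≈ 0#
  factor≈0⇒factors≈0 {X} = vanish
    where
    right : ∀ a {b} → b ≈ 0# → a * b ≈ 0#
    right a b≈0 = trans (*-congˡ b≈0) (zeroʳ a)
    left : ∀ {a} b → a ≈ 0# → a * b ≈ 0#
    left b a≈0 = trans (*-congʳ a≈0) (zeroˡ b)
    vanish : ∀ i → factor X i ≈ 0# → factors X ≈ 0#
    vanish zero                   e = left _ e
    vanish (suc zero)             e = right _ (left _ e)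
    vanish (suc (suc zero))       e = right _ (right _ (left _ e))
    vanish (suc (suc (suc zero))) e = right _ (right _ (right _ e))

  factors≈0⇒factor≈0 : ∀ {X} → factors X ≈ 0# → ∃ λ i → factor X i ≈ 0#
  factors≈0⇒factor≈0 {X} e =
    first (x*y≈0⇒x≈0∨y≈0 e)
    where
    third : factor X (suc (suc zero)) ≈ 0# ⊎ factor X (suc (suc (suc zero))) ≈ 0# → ∃ λ i → factor X i ≈ 0#
    third (inj₁ e₂) = suc (suc zero) , e₂
    third (inj₂ e₃) = suc (suc (suc zero)) , e₃
    second : factor X (suc zero) ≈ 0# ⊎ factor X (suc (suc zero)) * factor X (suc (suc (suc zero))) ≈ 0# →
      ∃ λ i → factor X i ≈ 0#
    second (inj₁ e₁) = suc zero , e₁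
    second (inj₂ e′) = third (x*y≈0⇒x≈0∨y≈0 e′)
    first : factor X zero ≈ 0# ⊎ factor X (suc zero) * (factor X (suc (suc zero)) * factor X (suc (suc (suc zero)))) ≈ 0# →
      ∃ λ i → factor X i ≈ 0#
    first (inj₁ e₀) = zero , e₀
    first (inj₂ e′) = second (x*y≈0⇒x≈0∨y≈0 e′)

  root-ψ₅≈0 : ∀ i {X} → fromℤ (+ 5) * X ≈ ⟦ d i ⟧ * C → ψ₅ X C ≈ 0#
  root-ψ₅≈0 i {X} 5X≈dC = *-cancel-0 (fromℤ-≉0 124)
    (trans (ψ₅-factors X) (factor≈0⇒factors≈0 i (x≈y⇒x∙y⁻¹≈ε 5X≈dC)))

  ψ₅≈0-root : ∀ {X} → ψ₅ X C ≈ 0# → ∃ λ i → fromℤ (+ 5) * X ≈ ⟦ d i ⟧ * C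
  ψ₅≈0-root {X} ψ≈0 = map₂ x-y≈0⇒x≈y
    (factors≈0⇒factor≈0 (trans (sym (ψ₅-factors X)) (trans (*-congˡ ψ≈0) (zeroʳ _))))

  d₀r³≈d : ∀ i → ⟦ d zero ⟧ * ⟦ r i ⟧ ^ 3 ≈ ⟦ d i ⟧
  d₀r³≈d i = *-cube {d zero} {r i} (d₀r³≡d i)

  [d₀+5]s²≈d+5 : ∀ i → (⟦ d zero ⟧ + fromℤ (+ 5)) * ⟦ s i ⟧ ^ 2 ≈ ⟦ d i ⟧ + fromℤ (+ 5)
  [d₀+5]s²≈d+5 i = trans (*-congʳ (+5 (d zero)))
    (trans (*-square {d zero A.+ ⟨ + 5 ∣ + 0 ⟩} {s i} ([d₀+5]s²≡d+5 i)) (sym (+5 (d i))))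
    where
    +5 : ∀ a → ⟦ a ⟧ + fromℤ (+ 5) ≈ ⟦ a A.+ ⟨ + 5 ∣ + 0 ⟩ ⟧
    +5 a = sym (trans (⟦⟧-+ a ⟨ + 5 ∣ + 0 ⟩) (+-congˡ (⟦⟨a∣0⟩⟧ (+ 5))))

  ⟦⟧∈ : ∀ {p} {F : Pred Carrier p} → IsSubfield F → F ω → F η → F ζ → ∀ a → F ⟦ a ⟧
  ⟦⟧∈ isSubfield ω∈ η∈ ζ∈ (((a₀ +θ a₁) +θ (a₂ +θ a₃)) +θ ((a₄ +θ a₅) +θ (a₆ +θ a₇))) =
    add (add (pair a₀ a₁) (mul (pair a₂ a₃) η∈)) (mul (add (pair a₄ a₅) (mul (pair a₆ a₇) η∈)) ζ∈)
    where
    open IsSubfield isSubfield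
    pair : ∀ a b → _
    pair a b = add (integer a) (mul (integer b) ω∈)

  module _ (x₀ y₀ : Carrier) (x₀³≈δ₁c : x₀ ^ 3 ≈ δ₁ ω ζ * C) (y₀²≈[δ₁+1]c : y₀ ^ 2 ≈ (δ₁ ω ζ + 1#) * C) where

    5x₀³≈d₀c : fromℤ (+ 5) * x₀ ^ 3 ≈ ⟦ d zero ⟧ * C
    5x₀³≈d₀c = trans (*-congˡ x₀³≈δ₁c) (trans (sym (*-assoc _ _ _)) (*-congʳ 5δ₁≈d₀))

    y₀²≈x₀³+c : y₀ ^ 2 ≈ x₀ ^ 3 + C
    y₀²≈x₀³+c = trans y₀²≈[δ₁+1]c (trans (distribʳ C _ _) (+-cong (sym x₀³≈δ₁c) (*-identityˡ C)))

    5[rx₀]³≈dc : ∀ i → fromℤ (+ 5) * (⟦ r i ⟧ * x₀) ^ 3 ≈ ⟦ d i ⟧ * C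
    5[rx₀]³≈dc i = begin
      fromℤ (+ 5) * (⟦ r i ⟧ * x₀) ^ 3     ≈⟨ solve 3 (λ n r x → n :* (r :* x) :^ 3 := (n :* x :^ 3) :* r :^ 3) refl _ ⟦ r i ⟧ x₀ ⟩
      fromℤ (+ 5) * x₀ ^ 3 * ⟦ r i ⟧ ^ 3   ≈⟨ *-congʳ 5x₀³≈d₀c ⟩
      ⟦ d zero ⟧ * C * ⟦ r i ⟧ ^ 3         ≈⟨ solve 3 (λ d c r → d :* c :* r := d :* r :* c) refl ⟦ d zero ⟧ C _ ⟩
      ⟦ d zero ⟧ * ⟦ r i ⟧ ^ 3 * C         ≈⟨ *-congʳ (d₀r³≈d i) ⟩
      ⟦ d i ⟧ * C                          ∎
      where open ℤ-Solver hiding (⟦_⟧)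

    [sy₀]²≈[rx₀]³+c : ∀ i → (⟦ s i ⟧ * y₀) ^ 2 ≈ (⟦ r i ⟧ * x₀) ^ 3 + C
    [sy₀]²≈[rx₀]³+c i = *-cancelˡ (fromℤ-≉0 4) (begin
      fromℤ (+ 5) * (⟦ s i ⟧ * y₀) ^ 2
        ≈⟨ solve 3 (λ n s y → n :* (s :* y) :^ 2 := (n :* y :^ 2) :* s :^ 2) refl _ ⟦ s i ⟧ y₀ ⟩
      fromℤ (+ 5) * y₀ ^ 2 * ⟦ s i ⟧ ^ 2                   ≈⟨ *-congʳ (*-congˡ y₀²≈x₀³+c) ⟩
      fromℤ (+ 5) * (x₀ ^ 3 + C) * ⟦ s i ⟧ ^ 2             ≈⟨ *-congʳ (distribˡ _ _ _) ⟩
      (fromℤ (+ 5) * x₀ ^ 3 + fromℤ (+ 5) * C) * ⟦ s i ⟧ ^ 2 ≈⟨ *-congʳ (+-congʳ 5x₀³≈d₀c) ⟩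
      (⟦ d zero ⟧ * C + fromℤ (+ 5) * C) * ⟦ s i ⟧ ^ 2
        ≈⟨ solve 4 (λ d n c s → (d :* c :+ n :* c) :* s := (d :+ n) :* s :* c) refl ⟦ d zero ⟧ _ C _ ⟩
      (⟦ d zero ⟧ + fromℤ (+ 5)) * ⟦ s i ⟧ ^ 2 * C         ≈⟨ *-congʳ ([d₀+5]s²≈d+5 i) ⟩
      (⟦ d i ⟧ + fromℤ (+ 5)) * C                          ≈⟨ distribʳ C _ _ ⟩
      ⟦ d i ⟧ * C + fromℤ (+ 5) * C                        ≈⟨ +-congʳ (5[rx₀]³≈dc i) ⟨
      fromℤ (+ 5) * (⟦ r i ⟧ * x₀) ^ 3 + fromℤ (+ 5) * C   ≈⟨ distribˡ _ _ _ ⟨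
      fromℤ (+ 5) * ((⟦ r i ⟧ * x₀) ^ 3 + C)               ∎)
      where open ℤ-Solver hiding (⟦_⟧)

    -- For the root d i / 5 the point (x , y) has the same x³ and y² as (r i x₀ , s i y₀);
    -- extracting the roots costs a power of ω and a sign.
    coordinates∈ : ∀ {p} {F : Pred Carrier p} → IsSubfield F → F ω → F η → F ζ → F x₀ → F y₀ →
      ∀ {x y} → Torsion 5 c₀ (aff x y) → F x × F y
    coordinates∈ {F = F} isSubfield ω∈ η∈ ζ∈ x₀∈ y₀∈ {x} {y} torsion = coordinates (ψ₅≈0-root (5-torsion⇒ψ₅≈0 c₀ c₀≉0 torsion))
      where
      open IsSubfield isSubfield
      coordinates : (∃ λ i → fromℤ (+ 5) * x ^ 3 ≈ ⟦ d i ⟧ * C) → F x × F y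
      coordinates (i , 5x³≈dc) = x∈ (x³≈y³⇒x≈ωⁱy x³≈) , y∈ (x²≈y²⇒x≈±y y²≈)
        where
        x³≈ : x ^ 3 ≈ (⟦ r i ⟧ * x₀) ^ 3
        x³≈ = *-cancelˡ (fromℤ-≉0 4) (trans 5x³≈dc (sym (5[rx₀]³≈dc i)))
        y²≈ : y ^ 2 ≈ (⟦ s i ⟧ * y₀) ^ 2
        y²≈ = trans (proj₁ torsion) (trans (+-congʳ x³≈) (sym ([sy₀]²≈[rx₀]³+c i)))
        x∈ : (∃ λ j → x ≈ ω ^ j * (⟦ r i ⟧ * x₀)) → F x
        x∈ (j , x≈) = resp (sym x≈) (mul (pow j ω∈) (mul (⟦⟧∈ isSubfield ω∈ η∈ ζ∈ (r i)) x₀∈))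
        sy₀∈ : F (⟦ s i ⟧ * y₀)
        sy₀∈ = mul (⟦⟧∈ isSubfield ω∈ η∈ ζ∈ (s i)) y₀∈
        y∈ : y ≈ ⟦ s i ⟧ * y₀ ⊎ y ≈ - (⟦ s i ⟧ * y₀) → F y
        y∈ (inj₁ y≈) = resp (sym y≈) sy₀∈
        y∈ (inj₂ y≈) = resp (sym y≈) (neg sy₀∈)

    module Generators where
      open IsSubfield (K⟮⟯-isSubfield {TorsionCoordinate 5 c₀})

      private
        D : Pred Carrier _
        D = DivisionField 5 c₀

        x∈ : ∀ {x y} → Torsion 5 c₀ (aff x y) → D x
        x∈ torsion = ⟮gen⟯ (_ , _ , torsion , inj₁ refl)

        y∈ : ∀ {x y} → Torsion 5 c₀ (aff x y) → D y
        y∈ torsion = ⟮gen⟯ (_ , _ , torsion , inj₂ refl)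

        ψ₀≈0 : ψ₅ (x₀ ^ 3) C ≈ 0#
        ψ₀≈0 = root-ψ₅≈0 zero 5x₀³≈d₀c

        x₀≉0 : ¬ (x₀ ≈ 0#)
        x₀≉0 = ψ₅-root-≉0 c₀ c₀≉0 ψ₀≈0

        y₀≉0 : ¬ (y₀ ≈ 0#)
        y₀≉0 = ψ₅-root-y≉0 c₀ c₀≉0 y₀²≈x₀³+c ψ₀≈0

        P₀ : Torsion 5 c₀ (aff x₀ y₀)
        P₀ = ψ₅≈0⇒5-torsion c₀ c₀≉0 y₀²≈x₀³+c ψ₀≈0

        [ωx₀]³≈x₀³ : (ω * x₀) ^ 3 ≈ x₀ ^ 3
        [ωx₀]³≈x₀³ = trans (solve 2 (λ ω x → (ω :* x) :^ 3 := ω :^ 3 :* x :^ 3) refl ω x₀)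
          (trans (*-congʳ (proj₁ ω-primitive)) (*-identityˡ _))
          where open ℤ-Solver hiding (⟦_⟧)

        ωP₀ : Torsion 5 c₀ (aff (ω * x₀) y₀)
        ωP₀ = ψ₅≈0⇒5-torsion c₀ c₀≉0 (trans y₀²≈x₀³+c (+-congʳ (sym [ωx₀]³≈x₀³)))
          (trans (ψ₅-congˡ [ωx₀]³≈x₀³) ψ₀≈0)

        P : ∀ i → Torsion 5 c₀ (aff (⟦ r i ⟧ * x₀) (⟦ s i ⟧ * y₀))
        P i = ψ₅≈0⇒5-torsion c₀ c₀≉0 ([sy₀]²≈[rx₀]³+c i) (root-ψ₅≈0 i (5[rx₀]³≈dc i))

        quotient∈ : ∀ {a b} → ¬ (b ≈ 0#) → D b → D (a * b) → D a
        quotient∈ {a} {b} b≉0 b∈ ab∈ = resp (sym (/-unique b≉0 (*-comm b a))) (div b≉0 ab∈ b∈)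

      x₀∈ : D x₀
      x₀∈ = x∈ P₀

      y₀∈ : D y₀
      y₀∈ = y∈ P₀

      ω∈ : D ω
      ω∈ = quotient∈ x₀≉0 x₀∈ (x∈ ωP₀)

      private
        r∈ : ∀ i → D ⟦ r i ⟧
        r∈ i = quotient∈ x₀≉0 x₀∈ (x∈ (P i))

        s∈ : ∀ i → D ⟦ s i ⟧
        s∈ i = quotient∈ y₀≉0 y₀∈ (y∈ (P i))

        ⟨∣⟩∈ : ∀ a b → D ⟦ ⟨ a ∣ b ⟩ ⟧
        ⟨∣⟩∈ a b = resp (sym (⟦⟨a∣b⟩⟧ a b)) (add (integer a) (mul (integer b) ω∈))

        ηᴬ ζᴬ : A.Carrier
        ηᴬ = ⟨ + 0 , + 0 , + 1 , + 0 , + 0 , + 0 , + 0 , + 0 ⟩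
        ζᴬ = ⟨ + 0 , + 0 , + 0 , + 0 , + 1 , + 0 , + 0 , + 0 ⟩

        ⟦ηᴬ⟧≈η : ⟦ ηᴬ ⟧ ≈ η
        ⟦ηᴬ⟧≈η = trans (solve 3 (λ ω η ζ → ((o :+ o :* ω) :+ (con (+ 1) :+ o :* ω) :* η)
            :+ ((o :+ o :* ω) :+ (o :+ o :* ω) :* η) :* ζ := con (+ 1) :* η) refl ω η ζ)
          (trans (*-congʳ fromℤ-1) (*-identityˡ η))
          where
          open ℤ-Solver hiding (⟦_⟧)
          o : ∀ {n} → Polynomial n
          o = con (+ 0)

        ⟦ζᴬ⟧≈ζ : ⟦ ζᴬ ⟧ ≈ ζ
        ⟦ζᴬ⟧≈ζ = trans (solve 3 (λ ω η ζ → ((o :+ o :* ω) :+ (o :+ o :* ω) :* η)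
            :+ ((con (+ 1) :+ o :* ω) :+ (o :+ o :* ω) :* η) :* ζ := con (+ 1) :* ζ) refl ω η ζ)
          (trans (*-congʳ fromℤ-1) (*-identityˡ ζ))
          where
          open ℤ-Solver hiding (⟦_⟧)
          o : ∀ {n} → Polynomial n
          o = con (+ 0)

        ⟨n∣0⟩≉0 : ∀ n → ¬ (⟦ ⟨ + suc n ∣ + 0 ⟩ ⟧ ≈ 0#)
        ⟨n∣0⟩≉0 n e = fromℤ-≉0 n (trans (sym (⟦⟨a∣0⟩⟧ (+ suc n))) e)

        open ζ-Solver hiding (⟦_⟧)

        opaque
          unfolding r s

          -- Writing s₂, s₃, r₃ for the entries at those indices, √-3 (s₂ + s₃) - 2r₃ - 10 = 6η,
          -- where √-3 = 1 + 2ω.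
          6η∈ : D (⟦ ηᴬ ⟧ * ⟦ ⟨ + 6 ∣ + 0 ⟩ ⟧)
          6η∈ = resp (ζ-identity {0}
                (con ⟨ + 1 ∣ + 2 ⟩ :* (con (s (suc (suc zero))) :+ con (s (suc (suc (suc zero)))))
                  :- (con ⟨ + 2 ∣ + 0 ⟩ :* con (r (suc (suc (suc zero)))) :+ con ⟨ + 10 ∣ + 0 ⟩))
                (con ηᴬ :* con ⟨ + 6 ∣ + 0 ⟩) _ [])
              (sub (mul (⟨∣⟩∈ (+ 1) (+ 2)) (add (s∈ (suc (suc zero))) (s∈ (suc (suc (suc zero))))))
                   (add (mul (⟨∣⟩∈ (+ 2) (+ 0)) (r∈ (suc (suc (suc zero))))) (⟨∣⟩∈ (+ 10) (+ 0))))

        ⟦η⟧∈ : D ⟦ ηᴬ ⟧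
        ⟦η⟧∈ = quotient∈ (⟨n∣0⟩≉0 5) (⟨∣⟩∈ (+ 6) (+ 0)) 6η∈

        opaque
          unfolding s

          -- The last entry of `s` is -1 - 2ω - 2ωη - 2ζ, which is solved for ζ once ω and η are
          -- available.
          2ζ∈ : D (⟦ ζᴬ ⟧ * ⟦ ⟨ + 2 ∣ + 0 ⟩ ⟧)
          2ζ∈ = resp (ζ-identity {0}
                (:- (con (s (suc (suc (suc zero)))) :+ con ⟨ + 1 ∣ + 2 ⟩ :+ con ⟨ + 0 ∣ + 2 ⟩ :* con ηᴬ))
                (con ζᴬ :* con ⟨ + 2 ∣ + 0 ⟩) _ [])
              (neg (add (add (s∈ (suc (suc (suc zero)))) (⟨∣⟩∈ (+ 1) (+ 2))) (mul (⟨∣⟩∈ (+ 0) (+ 2)) ⟦η⟧∈)))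

      η∈ : D η
      η∈ = resp ⟦ηᴬ⟧≈η ⟦η⟧∈

      ζ∈ : D ζ
      ζ∈ = resp ⟦ζᴬ⟧≈ζ (quotient∈ (⟨n∣0⟩≉0 1) (⟨∣⟩∈ (+ 2) (+ 0)) 2ζ∈)

    private
      in-A in-B1 in-B2 in-C in-D : Set _
      in-A  = InK ω
      in-B1 = K⟨ ω ∷ [] ⟩ η
      in-B2 = K⟨ ω ∷ η ∷ [] ⟩ ζ
      in-C  = K⟨ ω ∷ ζ ∷ [] ⟩ x₀
      in-D  = K⟨ ω ∷ ζ ∷ [] ⟩ y₀
      A-B1-B2-D : List (Set _)
      A-B1-B2-D = in-A ∷ in-B1 ∷ in-B2 ∷ in-D ∷ []

      ωη ζηω xζηω yxζηω : List Carrier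
      ωη    = η ∷ ω ∷ []
      ζηω   = ζ ∷ ωη
      xζηω  = x₀ ∷ ζηω
      yxζηω = y₀ ∷ xζηω

      -1∈ : ∀ {xs} → K⟨ xs ⟩ (- 1#)
      -1∈ = IsSubfield.neg K⟮⟯-isSubfield (IsSubfield.1∈ K⟮⟯-isSubfield)

      1∈ : ∀ {xs} → K⟨ xs ⟩ 1#
      1∈ = IsSubfield.1∈ K⟮⟯-isSubfield

      ω∈ωη : K⟨ ωη ⟩ ω
      ω∈ωη = weaken head∈

      ω∈ζηω : K⟨ ζηω ⟩ ω
      ω∈ζηω = weaken ω∈ωη

      -- The conditions list ω first, whereas in the tower each new generator goes to the head. This
      -- and the next three inclusions translate between the two; `remove-η` works because η is made
      -- from ζ and its inverse.
      swap : K⟨ ω ∷ η ∷ [] ⟩ ⊆ K⟨ ωη ⟩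
      swap = adjoin-least K⟮⟯-isSubfield (adjoin-least K⟮⟯-isSubfield (K⟮⟯-least K⟮⟯-isSubfield λ ()) head∈) ω∈ωη

      unswap : K⟨ ωη ⟩ ⊆ K⟨ ω ∷ η ∷ [] ⟩
      unswap = adjoin-least K⟮⟯-isSubfield (adjoin-least K⟮⟯-isSubfield (K⟮⟯-least K⟮⟯-isSubfield λ ()) head∈) (weaken head∈)

      insert-η : K⟨ ω ∷ ζ ∷ [] ⟩ ⊆ K⟨ ζηω ⟩
      insert-η = adjoin-least K⟮⟯-isSubfield (adjoin-least K⟮⟯-isSubfield (K⟮⟯-least K⟮⟯-isSubfield λ ()) head∈) ω∈ζηω

      remove-η : K⟨ ζηω ⟩ ⊆ K⟨ ω ∷ ζ ∷ [] ⟩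
      remove-η = adjoin-least K⟮⟯-isSubfield (adjoin-least K⟮⟯-isSubfield (adjoin-least K⟮⟯-isSubfield
        (K⟮⟯-least K⟮⟯-isSubfield λ ()) head∈) (⟮add⟯ ζ∈ωζ (⟮inv⟯ (ζ≉0 ζ-primitive) ζ∈ωζ))) ζ∈ωζ
        where
        ζ∈ωζ : K⟨ ω ∷ ζ ∷ [] ⟩ ζ
        ζ∈ωζ = weaken head∈

      module ζηω = IsSubfield (K⟮⟯-isSubfield {_∈ ζηω})

      η∈ζηω : K⟨ ζηω ⟩ η
      η∈ζηω = weaken head∈

      x₀³∈ζηω : K⟨ ζηω ⟩ (x₀ ^ 3)
      x₀³∈ζηω = ζηω.resp (sym (/-unique (fromℤ-≉0 4) (5x₀³≈d₀c)))
        (ζηω.div (fromℤ-≉0 4) (ζηω.mul (⟦⟧∈ K⟮⟯-isSubfield ω∈ζηω η∈ζηω head∈ (d zero)) (ζηω.base c₀)) (ζηω.natural 5))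

      y₀²∈ζηω : K⟨ ζηω ⟩ (y₀ ^ 2)
      y₀²∈ζηω = ζηω.resp (sym (y₀²≈x₀³+c)) (ζηω.add x₀³∈ζηω (ζηω.base c₀))

      DivisionField⊆ : DivisionField 5 c₀ ⊆ K⟨ yxζηω ⟩
      DivisionField⊆ = K⟮⟯-least K⟮⟯-isSubfield λ
        { (x , y , torsion , inj₁ z≈x) → ⟮resp⟯ (sym z≈x) (proj₁ (both torsion))
        ; (x , y , torsion , inj₂ z≈y) → ⟮resp⟯ (sym z≈y) (proj₂ (both torsion)) }
        where
        both : ∀ {x y} → Torsion 5 c₀ (aff x y) → K⟨ yxζηω ⟩ x × K⟨ yxζηω ⟩ y
        both = coordinates∈ K⟮⟯-isSubfield
          (weaken (weaken ω∈ζηω)) (weaken (weaken η∈ζηω)) (weaken (weaken head∈)) (weaken head∈) head∈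

      ⊆DivisionField : K⟨ yxζηω ⟩ ⊆ DivisionField 5 c₀
      ⊆DivisionField = adjoin (adjoin (adjoin (adjoin (adjoin (K⟮⟯-least K⟮⟯-isSubfield λ ()) ω∈) η∈) ζ∈) x₀∈) y₀∈
        where
        open Generators
        adjoin : ∀ {θ xs} → K⟨ xs ⟩ ⊆ DivisionField 5 c₀ → DivisionField 5 c₀ θ → K⟨ θ ∷ xs ⟩ ⊆ DivisionField 5 c₀
        adjoin = adjoin-least K⟮⟯-isSubfield

    -- The nesting runs down the tower from y₀ to K. Where a condition names its field differently,
    -- `map′` carries the decision to the tower's field.
    degree : (A? : Dec in-A) (B1? : Dec in-B1) (B2? : Dec in-B2) (C? : Dec in-C) (D? : Dec in-D) →
      HasDegree (DivisionField 5 c₀) (2 ℕ.^ falses D? ℕ.* (3 ℕ.^ falses C? ℕ.*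
        (2 ℕ.^ falses B2? ℕ.* (2 ℕ.^ falses B1? ℕ.* (2 ℕ.^ falses A? ℕ.* 1)))))
    degree A? B1? B2? C? D? = HasDegree-resp ⊆DivisionField DivisionField⊆
      (quadratic-degree {p = 0#} {q = y₀ ^ 2} (IsSubfield.0∈ K⟮⟯-isSubfield) (weaken y₀²∈ζηω) y₀²≈ D?′
      (cubic-degree (ω²≈-ω-1 ω-primitive) ω∈ζηω x₀³∈ζηω refl C?′
      (quadratic-degree head∈ -1∈ (ζ²≈ηζ-1 ζ-primitive) (map′ swap unswap B2?)
      (quadratic-degree -1∈ 1∈ (η²≈1-η ζ-primitive) B1?
      (quadratic-degree -1∈ -1∈ (ω²≈-ω-1 ω-primitive) (map′ InK⊆K⟨[]⟩ K⟨[]⟩⊆InK A?)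
      (HasDegree-resp InK⊆K⟨[]⟩ K⟨[]⟩⊆InK InK-degree))))))
      where
      C?′ : Dec (K⟨ ζηω ⟩ x₀)
      C?′ = map′ insert-η remove-η C?
      D?′ : Dec (K⟨ xζηω ⟩ y₀)
      -- Condition (D) omits x₀, but the tower asks about y₀ after x₀ is adjoined. The way back is
      -- the descent of square roots along the cubic step.
      D?′ = map′ (weaken ∘ insert-η)
        (remove-η ∘ square-root-descends (ω²≈-ω-1 ω-primitive) ω∈ζηω x₀³∈ζηω y₀²∈ζηω C?′) D?
      y₀²≈ : y₀ * y₀ ≈ 0# * y₀ + y₀ ^ 2
      y₀²≈ = sym (trans (+-cong (zeroˡ y₀) (*-congˡ (*-identityʳ y₀))) (+-identityˡ _))

    exact-degree : ∀ {n} → ExactlyFalse n A-B1-B2-D → (C? : Dec in-C) →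
      HasDegree (DivisionField 5 c₀) (2 ℕ.^ n ℕ.* 3 ℕ.^ falses C?)
    exact-degree {n} exactly C? with uncons-decided exactly
    ... | A? , _ , B1-B2-D , n≡ with uncons-decided B1-B2-D
    ... | B1? , _ , B2-D , m≡ with uncons-decided B2-D
    ... | B2? , _ , only-D , l≡ with uncons-decided only-D
    ... | D? , _ , [] , k≡ = ≡.subst (HasDegree (DivisionField 5 c₀))
      (≡.trans (exponents (falses A?) (falses B1?) (falses B2?) (falses D?) (3 ℕ.^ falses C?))
        (≡.cong (λ n → 2 ℕ.^ n ℕ.* 3 ℕ.^ falses C?) (≡.sym count)))
      (degree A? B1? B2? C? D?)
      where
      count : n ≡ falses A? ℕ.+ (falses B1? ℕ.+ (falses B2? ℕ.+ (falses D? ℕ.+ 0)))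
      count = ≡.trans n≡ (≡.cong (falses A? ℕ.+_) (≡.trans m≡ (≡.cong (falses B1? ℕ.+_)
        (≡.trans l≡ (≡.cong (falses B2? ℕ.+_) k≡)))))
      exponents : ∀ a b₁ b₂ d t →
        2 ℕ.^ d ℕ.* (t ℕ.* (2 ℕ.^ b₂ ℕ.* (2 ℕ.^ b₁ ℕ.* (2 ℕ.^ a ℕ.* 1)))) ≡
        2 ℕ.^ (a ℕ.+ (b₁ ℕ.+ (b₂ ℕ.+ (d ℕ.+ 0)))) ℕ.* t
      exponents a b₁ b₂ d t
        rewrite ℕ.^-distribˡ-+-* 2 a (b₁ ℕ.+ (b₂ ℕ.+ (d ℕ.+ 0)))
              | ℕ.^-distribˡ-+-* 2 b₁ (b₂ ℕ.+ (d ℕ.+ 0))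
              | ℕ.^-distribˡ-+-* 2 b₂ (d ℕ.+ 0)
              | ℕ.+-identityʳ d =
        solve 5 (λ a b₁ b₂ d t → d :* (t :* (b₂ :* (b₁ :* (a :* con 1)))) := (a :* (b₁ :* (b₂ :* d))) :* t)
          ≡.refl (2 ℕ.^ a) (2 ℕ.^ b₁) (2 ℕ.^ b₂) (2 ℕ.^ d) t
        where open +-*-Solver

    -- Up to four conditions hold besides (C), so the degree is 2ⁿ or 3·2ⁿ with n ≤ 4: ten values,
    -- located one by one.
    possible-degree : ∀ {n} → ExactlyFalse n A-B1-B2-D → Dec in-C →
      Any (HasDegree (DivisionField 5 c₀)) (48 ∷ 24 ∷ 16 ∷ 12 ∷ 8 ∷ 6 ∷ 4 ∷ 3 ∷ 2 ∷ 1 ∷ [])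
    possible-degree {n} exactly C? = locate n (ExactlyFalse-≤-length exactly) C? (exact-degree exactly C?)
      where
      locate : ∀ n → n ≤ 4 → (C? : Dec in-C) → HasDegree (DivisionField 5 c₀) (2 ℕ.^ n ℕ.* 3 ℕ.^ falses C?) →
        Any (HasDegree (DivisionField 5 c₀)) (48 ∷ 24 ∷ 16 ∷ 12 ∷ 8 ∷ 6 ∷ 4 ∷ 3 ∷ 2 ∷ 1 ∷ [])
      locate 4 _ (no _)  h = here h
      locate 3 _ (no _)  h = there (here h)
      locate 4 _ (yes _) h = there (there (here h))
      locate 2 _ (no _)  h = there (there (there (here h)))
      locate 3 _ (yes _) h = there (there (there (there (here h))))
      locate 1 _ (no _)  h = there (there (there (there (there (here h)))))
      locate 2 _ (yes _) h = there (there (there (there (there (there (here h))))))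
      locate 0 _ (no _)  h = there (there (there (there (there (there (there (here h)))))))
      locate 1 _ (yes _) h = there (there (there (there (there (there (there (there (here h))))))))
      locate 0 _ (yes _) h = there (there (there (there (there (there (there (there (there (here h)))))))))
      locate (suc (suc (suc (suc (suc _))))) (s≤s (s≤s (s≤s (s≤s ()))))

    -- The goal is a negation, so each of the five memberships may be assumed decided.
    degree-occurs : ¬ ¬ Any (HasDegree (DivisionField 5 c₀)) (48 ∷ 24 ∷ 16 ∷ 12 ∷ 8 ∷ 6 ∷ 4 ∷ 3 ∷ 2 ∷ 1 ∷ [])
    degree-occurs none =
      ¬¬-excluded-middle λ A? → ¬¬-excluded-middle λ B1? → ¬¬-excluded-middle λ B2? →
      ¬¬-excluded-middle λ C? → ¬¬-excluded-middle λ D? → none (possible-degree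
        (cons-decided A? (cons-decided B1? (cons-decided B2? (cons-decided D? [])))) C?)

theorem6p1 :
    ∀ {k ℓ k′ ℓ′} (K : NumberField k ℓ)
      (K̄ : AlgebraicClosure (NumberField.discreteField K) k′ ℓ′) →
    let module K = NumberField K
        open AlgebraicClosure K̄
        open Setting K K̄
    in
    (c : K.Carrier) → ¬ (c K.≈ K.0#) →
    (ζ₃ ζ₅ : Carrier) → PrimitiveRoot 3 ζ₃ → PrimitiveRoot 5 ζ₅ →
    (∛δ₁c √[δ₁+1]c : Carrier) →
    ∛δ₁c ^ 3 ≈ δ₁ ζ₃ ζ₅ * embed c →
    √[δ₁+1]c ^ 2 ≈ (δ₁ ζ₃ ζ₅ + 1#) * embed c →
    let [K₅:K]≡_ = HasDegree (DivisionField 5 c)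
        in-A  = InK ζ₃
        in-B1 = K⟨ ζ₃ ∷ [] ⟩ (ζ₅ + ζ₅ ⁻¹)
        in-B2 = K⟨ ζ₃ ∷ ζ₅ + ζ₅ ⁻¹ ∷ [] ⟩ ζ₅
        in-C  = K⟨ ζ₃ ∷ ζ₅ ∷ [] ⟩ ∛δ₁c
        in-D  = K⟨ ζ₃ ∷ ζ₅ ∷ [] ⟩ √[δ₁+1]c
        A-B1-B2-D = in-A ∷ in-B1 ∷ in-B2 ∷ in-D ∷ []
    in
    (¬ in-A × ¬ in-B1 × ¬ in-B2 × ¬ in-C × ¬ in-D → [K₅:K]≡ 48) ×
    (¬ in-C × ExactlyFalse 3 A-B1-B2-D → [K₅:K]≡ 24) ×
    (¬ in-A × ¬ in-B1 × ¬ in-B2 × in-C × ¬ in-D → [K₅:K]≡ 16) ×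
    (¬ in-C × ExactlyFalse 2 A-B1-B2-D → [K₅:K]≡ 12) ×
    (in-C × ExactlyFalse 3 A-B1-B2-D → [K₅:K]≡ 8) ×
    (¬ in-C × ExactlyFalse 1 A-B1-B2-D → [K₅:K]≡ 6) ×
    (in-C × ExactlyFalse 2 A-B1-B2-D → [K₅:K]≡ 4) ×
    (¬ in-C × ExactlyFalse 0 A-B1-B2-D → [K₅:K]≡ 3) ×
    (in-C × ExactlyFalse 1 A-B1-B2-D → [K₅:K]≡ 2) ×
    (in-C × ExactlyFalse 0 A-B1-B2-D → [K₅:K]≡ 1) ×
    -- One of the ten degrees always occurs. Double-negated because deciding
    -- the five memberships is not constructively available here; classically
    -- the double negation is void.
    ¬ ¬ Any [K₅:K]≡_ (48 ∷ 24 ∷ 16 ∷ 12 ∷ 8 ∷ 6 ∷ 4 ∷ 3 ∷ 2 ∷ 1 ∷ [])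
theorem6p1 K K̄ c c≉0 ζ₃ ζ₅ ζ₃-primitive ζ₅-primitive ∛δ₁c √[δ₁+1]c cube square =
    -- Each numeral of the statement is the value of `2 ℕ.^ n ℕ.* 3 ℕ.^ falses C?`, so the ten cases
    -- match by computation.
    (λ { (¬A , ¬B1 , ¬B2 , ¬C , ¬D) → exact (false∷ ¬A (false∷ ¬B1 (false∷ ¬B2 (false∷ ¬D [])))) (no ¬C) })
  , (λ { (¬C , exactly) → exact exactly (no ¬C) })
  , (λ { (¬A , ¬B1 , ¬B2 , C , ¬D) → exact (false∷ ¬A (false∷ ¬B1 (false∷ ¬B2 (false∷ ¬D [])))) (yes C) })
  , (λ { (¬C , exactly) → exact exactly (no ¬C) })
  , (λ { (C , exactly) → exact exactly (yes C) })
  , (λ { (¬C , exactly) → exact exactly (no ¬C) })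
  , (λ { (C , exactly) → exact exactly (yes C) })
  , (λ { (¬C , exactly) → exact exactly (no ¬C) })
  , (λ { (C , exactly) → exact exactly (yes C) })
  , (λ { (C , exactly) → exact exactly (yes C) })
  , degree-occurs ∛δ₁c √[δ₁+1]c cube square
  where
  open DivisionFieldDegree K K̄ c c≉0 ζ₃ ζ₅ ζ₃-primitive ζ₅-primitive
  exact : ∀ {n} → _ → _
  exact {n} = exact-degree ∛δ₁c √[δ₁+1]c cube square {n}
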